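{- Let $k\ge 4$. Among the $k-2$ images in $\mathrm{gr}^{W,L}_{k,2}(\mathcal{MD}^{adm})$ of the admissible brackets $[s_1,s_2]$ with $s_1\ge 2$, $s_2\ge1$, $s_1+s_2=k$, there are at least $\lfloor k/2\rfloor-1$ linearly independent linear relations over $\mathbb{Q}$ (i.e. the space of $(c_{s_1,s_2})\in\mathbb{Q}^{k-2}$ with $\sum c_{s_1,s_2}[s_1,s_2]=0$ in $\mathrm{gr}^{W,L}_{k,2}(\mathcal{MD}^{adm})$ has dimension at least $\lfloor k/2\rfloor-1$).
   Context: For integers $r_1,\dots,r_l\ge 0$ and $n\ge 1$ let $\sigma_{r_1,\dots,r_l}(n)=\sum v_1^{r_1}\cdots v_l^{r_l}$, summed over positive integers $u_1>\dots>u_l>0$, $v_1,\dots,v_l>0$ with $u_1v_1+\dots+u_lv_l=n$. For integers $s_1,\dots,s_l\ge1$ the bracket is $[s_1,\dots,s_l]=\frac{1}{(s_1-1)!\cdots(s_l-1)!}\sum_{n>0}\sigma_{s_1-1,\dots,s_l-1}(n)q^n\in\mathbb{Q}[[q]]$, of weight $s_1+\dots+s_l$ and length $l$ ($1$ has weight and length $0$). A bracket is admissible if $s_1>1$. $\mathcal{MD}^{adm}$ is the $\mathbb{Q}$-span of $1$ and all admissible brackets, $\mathrm{Fil}^{W,L}_{k,l}(\mathcal{MD}^{adm})$ the span of $1$ and admissible brackets of weight $\le k$ and length $\le l$, and $\mathrm{gr}^{W,L}_{k,l}(\mathcal{MD}^{adm})=\mathrm{Fil}^{W,L}_{k,l}(\mathcal{MD}^{adm})\big/\big(\mathrm{Fil}^{W,L}_{k-1,l}(\mathcal{MD}^{adm})+\mathrm{Fil}^{W,L}_{k,l-1}(\mathcal{MD}^{adm})\big)$.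 -}

module Defs where

open import Data.Nat as ℕ using (ℕ; zero; suc; _∸_; _^_; _!; _≤ᵇ_; _≤_; ⌊_/2⌋)
open import Data.Nat.Properties using (_!≢0)
open import Data.Bool using (if_then_else_)
open import Data.List as List using (List; []; _∷_; map; foldr; length)
open import Data.List.Relation.Unary.All using (All)
open import Data.Fin using (Fin; toℕ)
open import Data.Integer using (+_)
open import Data.Rational as ℚ using (ℚ; 0ℚ; 1ℚ)
open import Data.Product using (Σ; _×_; _,_; proj₂)
open import Data.Sum using (_⊎_)
open import Data.Empty using (⊥)
open import Relation.Binary.PropositionalEquality using (_≡_)

sumℕ : List ℕ → ℕ
sumℕ = foldr ℕ._+_ 0

range : ℕ → ℕ → List ℕ
range a zero    = []
range a (suc m) = a ∷ range (suc a) m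

-- sig rs n b = Σ over b > u₁ > u₂ > ... > u_l > 0, v_i > 0, Σ uᵢvᵢ = n,
--              of v₁^r₁ ⋯ v_l^r_l   (rs = r₁ ∷ ... ∷ r_l)
sig : List ℕ → ℕ → ℕ → ℕ
sig []       n b = if n ℕ.≡ᵇ 0 then 1 else 0
sig (r ∷ rs) n b =
  sumℕ (map (λ u →
    sumℕ (map (λ v →
      if u ℕ.* v ≤ᵇ n then v ^ r ℕ.* sig rs (n ∸ u ℕ.* v) u else 0)
      (range 1 n)))
    (range 1 (b ∸ 1)))

-- σ_{r₁,...,r_l}(n) (u₁ ≤ n automatically, so the bound n+1 imposes nothing).
-- For l = 0 this gives 1 at n = 0 and 0 otherwise; for l ≥ 1 it is 0 at n = 0.
σ : List ℕ → ℕ → ℕ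
σ rs n = sig rs n (suc n)

invFact : ℕ → ℚ
invFact s = ℚ._/_ (+ 1) ((s ∸ 1) !) {{(s ∸ 1) !≢0}}

-- n-th q-coefficient of the bracket [s₁,...,s_l]; the empty bracket is the constant 1.
bracket : List ℕ → ℕ → ℚ
bracket ss n = ℚ._*_ (ℚ._/_ (+ σ (map (_∸ 1) ss) n) 1)
                     (foldr (λ s acc → ℚ._*_ (invFact s) acc) 1ℚ ss)

weight : List ℕ → ℕ
weight = sumℕ

Admissible : List ℕ → Set
Admissible []      = ⊥
Admissible (s ∷ _) = 2 ≤ s

-- generators of Fil^{W,L}_{k,l}(MD^adm): the bracket 1 (= []) or an admissible
-- bracket (all sᵢ ≥ 1) of weight ≤ k and length ≤ l
Generator : ℕ → ℕ → List ℕ → Set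
Generator k l ss = (ss ≡ []) ⊎ (Admissible ss × All (1 ≤_) ss × weight ss ≤ k × length ss ≤ l)

linComb : List (ℚ × List ℕ) → ℕ → ℚ
linComb L n = foldr (λ { (c , ss) acc → ℚ._+_ (ℚ._*_ c (bracket ss n)) acc }) 0ℚ L

-- f ∈ Fil^{W,L}_{k,l}(MD^adm), as a q-series given by its coefficients
InFil : ℕ → ℕ → (ℕ → ℚ) → Set
InFil k l f = Σ (List (ℚ × List ℕ)) λ L →
  All (λ p → Generator k l (proj₂ p)) L × (∀ n → f n ≡ linComb L n)

InFilSum : ℕ → ℕ → (ℕ → ℚ) → Set
InFilSum k l f = Σ (ℕ → ℚ) λ g → Σ (ℕ → ℚ) λ h →
  InFil (k ∸ 1) l g × InFil k (l ∸ 1) h × (∀ n → f n ≡ ℚ._+_ (g n) (h n))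

ΣFin : (m : ℕ) → (Fin m → ℚ) → ℚ
ΣFin zero    f = 0ℚ
ΣFin (suc m) f = ℚ._+_ (f Data.Fin.zero) (ΣFin m (λ i → f (Data.Fin.suc i)))

br2 : (k : ℕ) → Fin (k ∸ 2) → List ℕ
br2 k i = (2 ℕ.+ toℕ i) ∷ (k ∸ (2 ℕ.+ toℕ i)) ∷ []

-- c is a linear relation among the images of [s₁,s₂] (s₁+s₂=k) in gr^{W,L}_{k,2}
IsRelation : (k : ℕ) → (Fin (k ∸ 2) → ℚ) → Set
IsRelation k c = InFilSum k 2 (λ n → ΣFin (k ∸ 2) (λ i → ℚ._*_ (c i) (bracket (br2 k i) n)))

LinIndep : (m d : ℕ) → (Fin m → Fin d → ℚ) → Set
LinIndep m d v = (a : Fin m → ℚ) →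
  (∀ i → ΣFin m (λ j → ℚ._*_ (a j) (v j i)) ≡ 0ℚ) → ∀ j → a j ≡ 0ℚ

{-# OPTIONS --safe #-}

-- Put N = k − 2 and, for a + b = N, let T(a,b) be the sum of v₁^a v₂^b over all positive
-- solutions of u₁v₁ + u₂v₂ = n.  Splitting by the order of u₁, u₂ (stuffle) gives
-- σ_{a,b} + σ_{b,a} plus a diagonal term, a combination of the σ_r with r ≤ N + 1, hence
-- of length-one brackets.  Splitting by the order of v₁, v₂ and conjugating (shuffle) gives
-- Σ_j (C(a,j) + C(b,j)) σ_{N−j,j} plus a diagonal term depending on N only.  Comparing
-- (a,b) with (N,0) cancels the second diagonal, which is not a combination of brackets of
-- length one (it involves n σ_{N−1}), and one gets a relation for each 1 ≤ a ≤ N/2.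
-- The relations are independent because the matrix [i = j] − C(i,j) is strictly lower
-- triangular with nonzero entries just below the diagonal.
module Submission where

open import Defs
open import Algebra.Bundles using (CommutativeRing; CommutativeSemiring)
open import Data.Bool using (true; false; T; if_then_else_)
open import Data.Empty using (⊥-elim)
open import Data.Fin as Fin using (Fin; toℕ; fromℕ<)
import Data.Fin.Properties as Fin
import Data.Integer as ℤ
import Data.Integer.Properties as ℤ
open import Data.List using ([]; _∷_; map)
open import Data.List.Relation.Unary.All using ([]; _∷_)
open import Data.Nat as ℕ
  using (ℕ; zero; suc; _∸_; _^_; _!; _≤_; _<_; _≡ᵇ_; _≤ᵇ_; z≤n; s≤s; NonZero; ⌊_/2⌋)
open import Data.Nat.Combinatorics
  using (_C_; nCk+nC[k+1]≡[n+1]C[k+1]; nCk≡nC[n∸k]; k>n⇒nCk≡0; nCn≡1; nC1≡n)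
import Data.Nat.Properties as ℕ
open import Data.Nat.Tactic.RingSolver using (solve-∀)
open import Data.Product using (Σ; _×_; _,_)
open import Data.Rational as ℚ using (ℚ; 0ℚ; 1ℚ; fromℚᵘ)
import Data.Rational.Properties as ℚ
open import Data.Rational.Solver using (module +-*-Solver)
open import Data.Rational.Unnormalised as ℚᵘ using (mkℚᵘ; *≡*)
import Data.Rational.Unnormalised.Properties as ℚᵘ
open import Data.Sum using (inj₁; inj₂)
open import Function using (_∘_; flip)
open import Level using (0ℓ)
open import Relation.Binary.Definitions using (tri<; tri≈; tri>)
open import Relation.Binary.PropositionalEquality
  using (_≡_; _≢_; refl; sym; trans; cong; cong₂; subst; module ≡-Reasoning)
open import Relation.Nullary using (yes; no)

-- Finite sums over a commutative semiring.

module Summation (R : CommutativeSemiring 0ℓ 0ℓ) where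
  open CommutativeSemiring R
    using (Carrier; _≈_; 0#; setoid; +-cong; +-congˡ; +-identityˡ; +-identityʳ; +-assoc; +-comm;
           distribˡ; zeroʳ; +-commutativeSemigroup)
    renaming (_+_ to _⊕_; _*_ to _⊛_; refl to ≈-refl; sym to ≈-sym; trans to ≈-trans)
  open import Algebra.Properties.CommutativeSemigroup +-commutativeSemigroup using (interchange; x∙yz≈y∙xz)
  open import Relation.Binary.Reasoning.Setoid setoid

  Σ< : ℕ → (ℕ → Carrier) → Carrier
  Σ< zero    f = 0#
  Σ< (suc n) f = f 0 ⊕ Σ< n (f ∘ suc)

  Σ-cong : ∀ n {f g} → (∀ i → i < n → f i ≈ g i) → Σ< n f ≈ Σ< n g
  Σ-cong zero    f≈g = ≈-refl
  Σ-cong (suc n) f≈g = +-cong (f≈g 0 (s≤s z≤n)) (Σ-cong n λ i i<n → f≈g (suc i) (s≤s i<n))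

  Σ-zero : ∀ n {f} → (∀ i → i < n → f i ≈ 0#) → Σ< n f ≈ 0#
  Σ-zero zero    f≈0 = ≈-refl
  Σ-zero (suc n) f≈0 =
    ≈-trans (+-cong (f≈0 0 (s≤s z≤n)) (Σ-zero n λ i i<n → f≈0 (suc i) (s≤s i<n))) (+-identityˡ 0#)

  Σ-+ : ∀ n f g → Σ< n (λ i → f i ⊕ g i) ≈ Σ< n f ⊕ Σ< n g
  Σ-+ zero    f g = ≈-sym (+-identityˡ 0#)
  Σ-+ (suc n) f g = ≈-trans (+-congˡ (Σ-+ n (f ∘ suc) (g ∘ suc))) (interchange _ _ _ _)

  Σ-*ˡ : ∀ n c f → Σ< n (λ i → c ⊛ f i) ≈ c ⊛ Σ< n f
  Σ-*ˡ zero    c f = ≈-sym (zeroʳ c)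
  Σ-*ˡ (suc n) c f = ≈-trans (+-congˡ (Σ-*ˡ n c (f ∘ suc))) (≈-sym (distribˡ c _ _))

  Σ-swap : ∀ m n (f : ℕ → ℕ → Carrier) → Σ< m (λ i → Σ< n (f i)) ≈ Σ< n (λ j → Σ< m (λ i → f i j))
  Σ-swap zero    n f = ≈-sym (Σ-zero n λ _ _ → ≈-refl)
  Σ-swap (suc m) n f = ≈-trans (+-congˡ (Σ-swap m n (f ∘ suc))) (≈-sym (Σ-+ n _ _))

  Σ-swap² : ∀ m n k l (f : ℕ → ℕ → ℕ → ℕ → Carrier) →
    Σ< m (λ a → Σ< n λ b → Σ< k λ c → Σ< l λ d → f a b c d) ≈
    Σ< k (λ c → Σ< l λ d → Σ< m λ a → Σ< n λ b → f a b c d)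
  Σ-swap² m n k l f = begin
    Σ< m (λ a → Σ< n λ b → Σ< k λ c → Σ< l λ d → f a b c d) ≈⟨ Σ-cong m (λ a _ → Σ-swap n k _) ⟩
    Σ< m (λ a → Σ< k λ c → Σ< n λ b → Σ< l λ d → f a b c d)
      ≈⟨ Σ-cong m (λ a _ → Σ-cong k λ c _ → Σ-swap n l _) ⟩
    Σ< m (λ a → Σ< k λ c → Σ< l λ d → Σ< n λ b → f a b c d) ≈⟨ Σ-swap m k _ ⟩
    Σ< k (λ c → Σ< m λ a → Σ< l λ d → Σ< n λ b → f a b c d) ≈⟨ Σ-cong k (λ c _ → Σ-swap m l _) ⟩
    Σ< k (λ c → Σ< l λ d → Σ< m λ a → Σ< n λ b → f a b c d) ∎

  Σ-linear : ∀ m n (c : ℕ → Carrier) (f : ℕ → ℕ → Carrier) →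
    Σ< m (λ i → Σ< n (λ j → c j ⊛ f j i)) ≈ Σ< n (λ j → c j ⊛ Σ< m (f j))
  Σ-linear m n c f = ≈-trans (Σ-swap m n _) (Σ-cong n λ j _ → Σ-*ˡ m (c j) (f j))

  Σ-last : ∀ n f → Σ< (suc n) f ≈ Σ< n f ⊕ f n
  Σ-last zero    f = +-comm _ _
  Σ-last (suc n) f = ≈-trans (+-congˡ (Σ-last n (f ∘ suc))) (≈-sym (+-assoc _ _ _))

  Σ-reverse : ∀ n (f : ℕ → Carrier) → Σ< n f ≈ Σ< n (λ i → f (n ∸ suc i))
  Σ-reverse zero    f = ≈-refl
  Σ-reverse (suc n) f = ≈-trans (Σ-last n f) (≈-trans (+-comm _ _) (+-congˡ (Σ-reverse n f)))

  Σ-extend : ∀ {m n} (f : ℕ → Carrier) → m ≤ n → (∀ i → m ≤ i → f i ≈ 0#) → Σ< n f ≈ Σ< m f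
  Σ-extend {n = n} f z≤n f≈0 = Σ-zero n λ i _ → f≈0 i z≤n
  Σ-extend f (s≤s m≤n) f≈0 = +-congˡ (Σ-extend (f ∘ suc) m≤n λ i m≤i → f≈0 (suc i) (s≤s m≤i))

  -- Induction peels off row 0 and column 0. The column `c` joins the triangle below the diagonal,
  -- the row `r` the one above.
  Σ-square : ∀ n (f : ℕ → ℕ → Carrier) → Σ< n (λ i → Σ< n (f i)) ≈
    Σ< n (λ i → f i i) ⊕ (Σ< n (λ i → Σ< i (f i)) ⊕ Σ< n (λ j → Σ< j (λ i → f i j)))
  Σ-square zero    f = ≈-sym (≈-trans (+-identityˡ _) (+-identityˡ _))
  Σ-square (suc n) f = begin
    (f 0 0 ⊕ r) ⊕ Σ< n (λ i → f (suc i) 0 ⊕ Σ< n (f (suc i) ∘ suc))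
      ≈⟨ +-congˡ (≈-trans (Σ-+ n _ _) (+-congˡ (Σ-square n (λ i → f (suc i) ∘ suc)))) ⟩
    (f 0 0 ⊕ r) ⊕ (c ⊕ (d ⊕ (l ⊕ u)))     ≈⟨ +-congˡ (x∙yz≈y∙xz _ _ _) ⟩
    (f 0 0 ⊕ r) ⊕ (d ⊕ (c ⊕ (l ⊕ u)))     ≈⟨ interchange _ _ _ _ ⟩
    (f 0 0 ⊕ d) ⊕ (r ⊕ (c ⊕ (l ⊕ u)))     ≈⟨ +-congˡ (≈-trans (+-congˡ (≈-sym (+-assoc _ _ _))) (x∙yz≈y∙xz _ _ _)) ⟩
    (f 0 0 ⊕ d) ⊕ ((c ⊕ l) ⊕ (r ⊕ u))
      ≈⟨ +-congˡ (+-cong (peel _ _) (peel _ _)) ⟨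
    (f 0 0 ⊕ d) ⊕ (Σ< (suc n) (λ i → Σ< i (f i)) ⊕ Σ< (suc n) (λ j → Σ< j (λ i → f i j))) ∎
    where
    r = Σ< n (f 0 ∘ suc)
    c = Σ< n (λ i → f (suc i) 0)
    d = Σ< n (λ i → f (suc i) (suc i))
    l = Σ< n (λ i → Σ< i (f (suc i) ∘ suc))
    u = Σ< n (λ j → Σ< j (λ i → f (suc i) (suc j)))
    peel : ∀ (g h : ℕ → Carrier) → 0# ⊕ Σ< n (λ i → g i ⊕ h i) ≈ Σ< n g ⊕ Σ< n h
    peel g h = ≈-trans (+-identityˡ _) (Σ-+ n g h)

  -- The substitution i = j + 1 + w. As `f` vanishes for i ≥ m, w may run up to the same `n` for
  -- every j, and the triangle becomes a rectangle whose sums can be exchanged.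
  Σ-triangle : ∀ {n} m (f : ℕ → ℕ → Carrier) → m ≤ n → (∀ i j → m ≤ i → f i j ≈ 0#) →
    Σ< m (λ i → Σ< i (f i)) ≈ Σ< m (λ j → Σ< n (λ w → f (suc (j ℕ.+ w)) j))
  Σ-triangle zero    f m≤n f≈0 = ≈-refl
  Σ-triangle {n} (suc m) f m<n f≈0 = begin
    0# ⊕ Σ< m (λ i → f (suc i) 0 ⊕ Σ< i (f (suc i) ∘ suc))
      ≈⟨ ≈-trans (+-identityˡ _) (Σ-+ m _ _) ⟩
    Σ< m (λ i → f (suc i) 0) ⊕ Σ< m (λ i → Σ< i (f (suc i) ∘ suc))
      ≈⟨ +-cong (≈-sym (Σ-extend _ m≤n λ i m≤i → f≈0 (suc i) 0 (s≤s m≤i)))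
                (Σ-triangle m (λ i → f (suc i) ∘ suc) m≤n λ i j m≤i → f≈0 _ _ (s≤s m≤i)) ⟩
    Σ< n (λ w → f (suc w) 0) ⊕ Σ< m (λ j → Σ< n (λ w → f (suc (suc (j ℕ.+ w))) (suc j))) ∎
    where m≤n = ℕ.≤-trans (ℕ.n≤1+n m) m<n

module S = Summation ℕ.+-*-commutativeSemiring
module Q = Summation (CommutativeRing.commutativeSemiring ℚ.+-*-commutativeRing)

-- Solutions of u₁v₁ + u₂v₂ = n: stuffle and shuffle.

module DoubleShuffle where
  open import Data.Nat using (_+_; _*_)
  open import Algebra.Properties.CommutativeSemigroup ℕ.*-commutativeSemigroup
    using () renaming (x∙yz≈y∙xz to *-leftSwap)
  open S

  -- In this form `sig []` at n is `δ n 0` by definition.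
  δ : ℕ → ℕ → ℕ
  δ m n = if m ≡ᵇ n then 1 else 0

  δ-refl : ∀ n → δ n n ≡ 1
  δ-refl zero    = refl
  δ-refl (suc n) = δ-refl n

  δ-≢ : ∀ {m n} → m ≢ n → δ m n ≡ 0
  δ-≢ {m} {n} m≢n with m ≡ᵇ n in eq
  ... | false = refl
  ... | true  = ⊥-elim (m≢n (ℕ.≡ᵇ⇒≡ m n (subst T (sym eq) _)))

  -- Solutions of u₁v₁ + u₂v₂ = n, each weighted by φ v₁ v₂; all variables are positive,
  -- so the summation indices are their predecessors.
  term : ℕ → (ℕ → ℕ → ℕ) → ℕ → ℕ → ℕ → ℕ → ℕ
  term n φ u₁ u₂ v₁ v₂ = δ n (suc u₁ * suc v₁ + suc u₂ * suc v₂) * φ (suc v₁) (suc v₂)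

  allSum decreasingSum equalSum decreasingSumᵛ equalSumᵛ : (ℕ → ℕ → ℕ) → ℕ → ℕ
  allSum         φ n = Σ< n λ u₁ → Σ< n λ u₂ → Σ< n λ v₁ → Σ< n λ v₂ → term n φ u₁ u₂ v₁ v₂
  decreasingSum  φ n = Σ< n λ u₁ → Σ< u₁ λ u₂ → Σ< n λ v₁ → Σ< n λ v₂ → term n φ u₁ u₂ v₁ v₂
  equalSum       φ n = Σ< n λ u → Σ< n λ v₁ → Σ< n λ v₂ → term n φ u u v₁ v₂
  decreasingSumᵛ φ n = Σ< n λ v₁ → Σ< v₁ λ v₂ → Σ< n λ u₁ → Σ< n λ u₂ → term n φ u₁ u₂ v₁ v₂
  equalSumᵛ      φ n = Σ< n λ v → Σ< n λ u₁ → Σ< n λ u₂ → term n φ u₁ u₂ v v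

  term-flip : ∀ n φ u₁ u₂ v₁ v₂ → term n φ u₁ u₂ v₁ v₂ ≡ term n (flip φ) u₂ u₁ v₂ v₁
  term-flip n φ u₁ u₂ v₁ v₂ =
    cong (λ s → δ n s * φ (suc v₁) (suc v₂)) (ℕ.+-comm (suc u₁ * suc v₁) (suc u₂ * suc v₂))

  module _ (n : ℕ) (φ : ℕ → ℕ → ℕ) where
    private
      -- (u₁ + 1)(v₁ + 1) ≥ u₁ + v₁ + 1 > n, so the equation has no solution. One bound serves both
      -- variables.
      vanish : ∀ u₁ u₂ v₁ v₂ → n ≤ u₁ + v₁ → term n φ u₁ u₂ v₁ v₂ ≡ 0
      vanish u₁ u₂ v₁ v₂ n≤ = cong (_* φ (suc v₁) (suc v₂)) (δ-≢ (ℕ.<⇒≢ n<s))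
        where
        n<s : n < suc u₁ * suc v₁ + suc u₂ * suc v₂
        n<s = ℕ.≤-trans (s≤s (ℕ.≤-trans n≤ (ℕ.≤-trans (ℕ.≤-reflexive (ℕ.+-comm u₁ v₁))
                (ℕ.+-monoʳ-≤ v₁ (ℕ.m≤m*n u₁ (suc v₁)))))) (ℕ.m≤m+n _ _)

    term-vanishᵘ : ∀ u₁ u₂ v₁ v₂ → n ≤ u₁ → term n φ u₁ u₂ v₁ v₂ ≡ 0
    term-vanishᵘ u₁ u₂ v₁ v₂ n≤u₁ = vanish u₁ u₂ v₁ v₂ (ℕ.≤-trans n≤u₁ (ℕ.m≤m+n u₁ v₁))

    term-vanishᵛ : ∀ u₁ u₂ v₁ v₂ → n ≤ v₁ → term n φ u₁ u₂ v₁ v₂ ≡ 0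
    term-vanishᵛ u₁ u₂ v₁ v₂ n≤v₁ = vanish u₁ u₂ v₁ v₂ (ℕ.≤-trans n≤v₁ (ℕ.m≤n+m v₁ u₁))

  -- The square of pairs (u₁, u₂) is cut along its diagonal. Where u₁ < u₂, exchanging the two
  -- products puts the larger u first and flips `φ`.
  stuffle : ∀ φ n → allSum φ n ≡ equalSum φ n + (decreasingSum φ n + decreasingSum (flip φ) n)
  stuffle φ n = trans (Σ-square n _) (cong (λ s → equalSum φ n + (decreasingSum φ n + s)) lemma)
    where
    lemma : Σ< n (λ u₂ → Σ< u₂ λ u₁ → Σ< n λ v₁ → Σ< n λ v₂ → term n φ u₁ u₂ v₁ v₂) ≡ decreasingSum (flip φ) n
    lemma = Σ-cong n λ u₂ _ → Σ-cong u₂ λ u₁ _ → trans (Σ-swap n n _)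
      (Σ-cong n λ v₂ _ → Σ-cong n λ v₁ _ → term-flip n φ u₁ u₂ v₁ v₂)

  stuffleᵛ : ∀ φ n → allSum φ n ≡ equalSumᵛ φ n + (decreasingSumᵛ φ n + decreasingSumᵛ (flip φ) n)
  stuffleᵛ φ n = trans (Σ-swap² n n n n _)
    (trans (Σ-square n _) (cong (λ s → equalSumᵛ φ n + (decreasingSumᵛ φ n + s)) lemma))
    where
    lemma : Σ< n (λ v₂ → Σ< v₂ λ v₁ → Σ< n λ u₁ → Σ< n λ u₂ → term n φ u₁ u₂ v₁ v₂) ≡ decreasingSumᵛ (flip φ) n
    lemma = Σ-cong n λ v₂ _ → Σ-cong v₂ λ v₁ _ → trans (Σ-swap n n _)
      (Σ-cong n λ u₂ _ → Σ-cong n λ u₁ _ → term-flip n φ u₁ u₂ v₁ v₂)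

  -- Conjugation of partitions: u₁(v₂ + w) + u₂v₂ = (u₁ + u₂)v₂ + u₁w.
  conjugate : ∀ φ n → decreasingSumᵛ φ n ≡ decreasingSum (λ x y → φ (x + y) x) n
  conjugate φ n = begin
    decreasingSumᵛ φ n
      ≡⟨ Σ-triangle n _ ℕ.≤-refl (λ v₁ v₂ n≤v₁ → Σ-zero n λ u₁ _ → Σ-zero n λ u₂ _ → term-vanishᵛ n φ u₁ u₂ v₁ v₂ n≤v₁) ⟩
    Σ< n (λ v₂ → Σ< n λ w → Σ< n λ u₁ → Σ< n λ u₂ → term n φ u₁ u₂ (suc (v₂ + w)) v₂)
      ≡⟨ Σ-swap² n n n n _ ⟩
    Σ< n (λ u₁ → Σ< n λ u₂ → Σ< n λ v₂ → Σ< n λ w → term n φ u₁ u₂ (suc (v₂ + w)) v₂)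
      ≡⟨ Σ-cong n (λ u₁ _ → Σ-cong n λ u₂ _ → Σ-cong n λ v₂ _ → Σ-cong n λ w _ →
           cong₂ _*_ (cong (δ n) (arith u₁ u₂ v₂ w)) (cong (λ s → φ s (suc v₂)) (cong suc (sym (ℕ.+-suc v₂ w))))) ⟩
    Σ< n (λ u₁ → Σ< n λ u₂ → Σ< n λ v₂ → Σ< n λ w → term n ψ (suc (u₁ + u₂)) u₁ v₂ w)
      ≡⟨ Σ-triangle n _ ℕ.≤-refl (λ u₁ u₂ n≤u₁ → Σ-zero n λ v₁ _ → Σ-zero n λ v₂ _ → term-vanishᵘ n ψ u₁ u₂ v₁ v₂ n≤u₁) ⟨
    decreasingSum ψ n ∎
    where
    open ≡-Reasoning
    ψ : ℕ → ℕ → ℕ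
    ψ x y = φ (x + y) x
    arith : ∀ u₁ u₂ v w → suc u₁ * suc (suc (v + w)) + suc u₂ * suc v ≡ suc (suc (u₁ + u₂)) * suc v + suc u₁ * suc w
    arith = solve-∀

  -- The same cut in the v-plane, after which conjugation returns both triangles to the order u₁ >
  -- u₂.
  shuffle : ∀ φ n → allSum φ n ≡ equalSumᵛ φ n +
    (decreasingSum (λ x y → φ (x + y) x) n + decreasingSum (λ x y → φ x (x + y)) n)
  shuffle φ n = trans (stuffleᵛ φ n)
    (cong (equalSumᵛ φ n +_) (cong₂ _+_ (conjugate φ n) (conjugate (flip φ) n)))

  decreasingSum-cong : ∀ {φ ψ} n → (∀ x y → φ x y ≡ ψ x y) → decreasingSum φ n ≡ decreasingSum ψ n
  decreasingSum-cong n φ≡ψ = Σ-cong n λ u₁ _ → Σ-cong u₁ λ u₂ _ → Σ-cong n λ v₁ _ → Σ-cong n λ v₂ _ →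
    cong (δ n _ *_) (φ≡ψ _ _)

  decreasingSum-linear : ∀ m (c : ℕ → ℕ) (φ : ℕ → ℕ → ℕ → ℕ) n →
    decreasingSum (λ x y → Σ< m (λ j → c j * φ j x y)) n ≡ Σ< m (λ j → c j * decreasingSum (φ j) n)
  decreasingSum-linear m c φ n =
    trans (Σ-cong n λ u₁ _ →
      trans (Σ-cong u₁ λ u₂ _ →
        trans (Σ-cong n λ v₁ _ →
          trans (Σ-cong n λ v₂ _ →
            let w = δ n (suc u₁ * suc v₁ + suc u₂ * suc v₂) in
            trans (sym (Σ-*ˡ m w _)) (Σ-cong m λ j _ → *-leftSwap w (c j) _))
          (Σ-linear n m c _))
        (Σ-linear n m c _))
      (Σ-linear u₁ m c _))
    (Σ-linear n m c _)

  -- Binomial expansion and the double shuffle identity.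

  mono : ℕ → ℕ → ℕ → ℕ → ℕ
  mono a b x y = x ^ a * y ^ b

  -- Induction on `a` by Pascal's rule. Any cut-off m > a is allowed because `a C j` vanishes for j
  -- > a: the induction needs both `suc m` and `m`, and `binomialSum` has one cut-off for all
  -- exponents.
  binomial : ∀ m a b x y → a < m →
    (x + y) ^ a * x ^ b ≡ Σ< m (λ j → (a C j) * mono ((a + b) ∸ j) j x y)
  binomial (suc m) zero b x y _ = sym (begin
    Σ< (suc m) (λ j → (0 C j) * mono (b ∸ j) j x y)
      ≡⟨ Σ-extend (λ j → (0 C j) * mono (b ∸ j) j x y) (s≤s (z≤n {m})) (λ { (suc j) _ → refl }) ⟩
    (x ^ b * 1 + 0) + 0  ≡⟨ simp (x ^ b) ⟩
    1 * x ^ b ∎)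
    where
    open ≡-Reasoning
    simp : ∀ z → (z * 1 + 0) + 0 ≡ 1 * z
    simp = solve-∀
  binomial (suc m) (suc a) b x y (s≤s a<m) = begin
    (x + y) * (x + y) ^ a * x ^ b
      ≡⟨ expand x y ((x + y) ^ a) (x ^ b) ⟩
    (x + y) ^ a * x ^ suc b + y * ((x + y) ^ a * x ^ b)
      ≡⟨ cong₂ (λ s t → s + y * t) (binomial (suc m) a (suc b) x y (ℕ.m<n⇒m<1+n a<m)) (binomial m a b x y a<m) ⟩
    Σ< (suc m) (λ j → (a C j) * mono ((a + suc b) ∸ j) j x y) + y * Σ< m (λ j → (a C j) * mono ((a + b) ∸ j) j x y)
      ≡⟨ cong₂ _+_ (Σ-cong (suc m) λ j _ → cong (λ s → (a C j) * mono (s ∸ j) j x y) (ℕ.+-suc a b)) (sym (Σ-*ˡ m y _)) ⟩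
    h + Σ< m f + Σ< m (λ j → y * ((a C j) * mono ((a + b) ∸ j) j x y))
      ≡⟨ cong (h + Σ< m f +_) (Σ-cong m λ j _ → shift y (a C j) (x ^ ((a + b) ∸ j)) (y ^ j)) ⟩
    h + Σ< m f + Σ< m g                          ≡⟨ ℕ.+-assoc h _ _ ⟩
    h + (Σ< m f + Σ< m g)                        ≡⟨ cong (h +_) (Σ-+ m f g) ⟨
    h + Σ< m (λ j → f j + g j)
      ≡⟨ cong (h +_) (Σ-cong m λ j _ → trans (sym (ℕ.*-distribʳ-+ _ (a C suc j) (a C j)))
           (cong (_* mono ((a + b) ∸ j) (suc j) x y)
             (trans (ℕ.+-comm (a C suc j) _) (nCk+nC[k+1]≡[n+1]C[k+1] a j)))) ⟩
    Σ< (suc m) (λ j → (suc a C j) * mono ((suc a + b) ∸ j) j x y) ∎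
    where
    open ≡-Reasoning
    h = (a C 0) * mono (suc (a + b)) 0 x y
    f g : ℕ → ℕ
    f j = (a C suc j) * mono ((a + b) ∸ j) (suc j) x y
    g j = (a C j) * mono ((a + b) ∸ j) (suc j) x y
    expand : ∀ x y p q → (x + y) * p * q ≡ p * (x * q) + y * (p * q)
    expand = solve-∀
    shift : ∀ y c p q → y * (c * (p * q)) ≡ c * (p * (y * q))
    shift = solve-∀

  module _ (n : ℕ) where

    -- The number σ_{N-j,j}(n), by `σ₂`.
    β : ℕ → ℕ → ℕ
    β N j = decreasingSum (mono (N ∸ j) j) n

    binomialSum : ℕ → ℕ → ℕ
    binomialSum N a = Σ< (suc N) λ j → (a C j) * β N j

    private
      expand : ∀ a b → decreasingSum (λ x y → (x + y) ^ a * x ^ b) n ≡ binomialSum (a + b) a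
      expand a b = trans (decreasingSum-cong n λ x y → binomial _ a b x y (s≤s (ℕ.m≤m+n a b)))
        (decreasingSum-linear (suc (a + b)) (a C_) (λ j → mono ((a + b) ∸ j) j) n)

    doubleShuffle : ∀ a b {N} → a + b ≡ N →
      equalSum (mono a b) n + (β N b + β N a) ≡
      equalSumᵛ (mono N 0) n + (binomialSum N a + binomialSum N b)
    doubleShuffle a b refl = begin
      equalSum (mono a b) n + (β (a + b) b + β (a + b) a)
        ≡⟨ cong (equalSum (mono a b) n +_) (cong₂ _+_
             (cong (λ s → decreasingSum (mono s b) n) (ℕ.m+n∸n≡m a b))
             (trans (cong (λ s → decreasingSum (mono s a) n) (ℕ.m+n∸m≡n a b))
               (decreasingSum-cong n λ x y → ℕ.*-comm (x ^ b) (y ^ a)))) ⟩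
      equalSum (mono a b) n + (decreasingSum (mono a b) n + decreasingSum (flip (mono a b)) n)
        ≡⟨ trans (sym (stuffle (mono a b) n)) (shuffle (mono a b) n) ⟩
      equalSumᵛ (mono a b) n +
        (decreasingSum (λ x y → (x + y) ^ a * x ^ b) n + decreasingSum (λ x y → x ^ a * (x + y) ^ b) n)
        ≡⟨ cong₂ _+_ diagonal (cong₂ _+_ (expand a b)
             (trans (decreasingSum-cong n λ x y → ℕ.*-comm (x ^ a) ((x + y) ^ b))
               (trans (expand b a) (cong (λ s → binomialSum s b) (ℕ.+-comm b a))))) ⟩
      equalSumᵛ (mono (a + b) 0) n + (binomialSum (a + b) a + binomialSum (a + b) b) ∎
      where
      open ≡-Reasoning
      -- For v₁ = v₂ the two powers merge to v^(a+b). The diagonal thus depends on a + b alone,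
      -- which lets it cancel between two pairs with the same sum.
      diagonal : equalSumᵛ (mono a b) n ≡ equalSumᵛ (mono (a + b) 0) n
      diagonal = Σ-cong n λ v _ → Σ-cong n λ u₁ _ → Σ-cong n λ u₂ _ →
        cong (δ n (suc u₁ * suc v + suc u₂ * suc v) *_) (trans (sym (ℕ.^-distribˡ-+-* (suc v) a b)) (sym (ℕ.*-identityʳ _)))

  -- Coefficients of brackets as sums over solutions.

  δ-shift : ∀ k m n → δ (k + m) (k + n) ≡ δ m n
  δ-shift zero    m n = refl
  δ-shift (suc k) m n = δ-shift k m n

  sumℕ-range : ∀ (f : ℕ → ℕ) a n → sumℕ (map f (range a n)) ≡ Σ< n (λ i → f (a + i))
  sumℕ-range f a zero    = refl
  sumℕ-range f a (suc n) = cong₂ _+_ (cong f (sym (ℕ.+-identityʳ a)))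
    (trans (sumℕ-range f (suc a) n) (Σ-cong n λ i _ → cong f (sym (ℕ.+-suc a i))))

  -- Removes the guard in `sig`: the unguarded value already vanishes when x exceeds n.
  if-≤ᵇ : ∀ x n {p q} → (x ≤ n → p ≡ q) → (n < x → q ≡ 0) → (if x ≤ᵇ n then p else 0) ≡ q
  if-≤ᵇ x n p≡q q≡0 with x ≤ᵇ n in eq
  ... | true  = p≡q (ℕ.≤ᵇ⇒≤ x n (subst T (sym eq) _))
  ... | false = sym (q≡0 (ℕ.≰⇒> λ x≤n → subst T eq (ℕ.≤⇒≤ᵇ x≤n)))

  δ-∸ : ∀ {x n} y → x ≤ n → δ (n ∸ x) y ≡ δ n (x + y)
  δ-∸ {x} {n} y x≤n = trans (sym (δ-shift x (n ∸ x) y)) (cong (λ m → δ m (x + y)) (ℕ.m+[n∸m]≡n x≤n))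

  -- The range of v may be enlarged to m, since v ≥ n makes (u + 1)(v + 1) exceed n. In `σ₂` this
  -- widens the inner range from n ∸ x to n.
  sig₁ : ∀ r {n m} b → n ≤ m →
    sig (r ∷ []) n (suc b) ≡ Σ< b λ u → Σ< m λ v → δ n (suc u * suc v) * suc v ^ r
  sig₁ r {n} {m} b n≤m = trans (sumℕ-range _ 1 b) (Σ-cong b λ u _ →
    trans (sumℕ-range _ 1 n) (trans (Σ-cong n λ v _ → step u v)
      (sym (Σ-extend _ n≤m λ v n≤v → cong (_* suc v ^ r)
        (δ-≢ (ℕ.<⇒≢ (ℕ.≤-trans (s≤s n≤v) (ℕ.m≤m+n (suc v) (u * suc v)))))))))
    where
    step : ∀ u v → (if suc u * suc v ≤ᵇ n then suc v ^ r * δ (n ∸ suc u * suc v) 0 else 0) ≡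
                   δ n (suc u * suc v) * suc v ^ r
    step u v = if-≤ᵇ (suc u * suc v) n
      (λ x≤n → trans (ℕ.*-comm (suc v ^ r) _)
        (cong (_* suc v ^ r) (trans (δ-∸ 0 x≤n) (cong (δ n) (ℕ.+-identityʳ (suc u * suc v))))))
      (λ n<x → cong (_* suc v ^ r) (δ-≢ (ℕ.<⇒≢ n<x)))

  σ₁ : ∀ r n → σ (r ∷ []) n ≡ Σ< n λ u → Σ< n λ v → δ n (suc u * suc v) * suc v ^ r
  σ₁ r n = sig₁ r {n} n ℕ.≤-refl

  σ₂ : ∀ a b n → σ (a ∷ b ∷ []) n ≡ decreasingSum (mono a b) n
  σ₂ a b n = trans (sumℕ-range _ 1 n) (Σ-cong n λ u₁ _ → trans (sumℕ-range _ 1 n)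
    (trans (Σ-cong n λ v₁ _ → step u₁ v₁) (Σ-swap n u₁ _)))
    where
    open ≡-Reasoning
    step : ∀ u₁ v₁ → let x = suc u₁ * suc v₁ in
      (if x ≤ᵇ n then suc v₁ ^ a * sig (b ∷ []) (n ∸ x) (suc u₁) else 0) ≡
      Σ< u₁ λ u₂ → Σ< n λ v₂ → term n (mono a b) u₁ u₂ v₁ v₂
    step u₁ v₁ = if-≤ᵇ x n (λ x≤n → begin
        suc v₁ ^ a * sig (b ∷ []) (n ∸ x) (suc u₁)
          ≡⟨ cong (suc v₁ ^ a *_) (sig₁ b u₁ (ℕ.m∸n≤m n x)) ⟩
        suc v₁ ^ a * Σ< u₁ (λ u₂ → Σ< n λ v₂ → δ (n ∸ x) (suc u₂ * suc v₂) * suc v₂ ^ b)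
          ≡⟨ Σ-*ˡ u₁ (suc v₁ ^ a) _ ⟨
        Σ< u₁ (λ u₂ → suc v₁ ^ a * Σ< n λ v₂ → δ (n ∸ x) (suc u₂ * suc v₂) * suc v₂ ^ b)
          ≡⟨ Σ-cong u₁ (λ u₂ _ → trans (sym (Σ-*ˡ n (suc v₁ ^ a) _)) (Σ-cong n λ v₂ _ →
               trans (*-leftSwap (suc v₁ ^ a) (δ (n ∸ x) (suc u₂ * suc v₂)) _)
                 (cong (_* mono a b (suc v₁) (suc v₂)) (δ-∸ (suc u₂ * suc v₂) x≤n)))) ⟩
        Σ< u₁ (λ u₂ → Σ< n λ v₂ → term n (mono a b) u₁ u₂ v₁ v₂) ∎)
      (λ n<x → Σ-zero u₁ λ u₂ _ → Σ-zero n λ v₂ _ → cong (_* mono a b (suc v₁) (suc v₂))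
        (δ-≢ (ℕ.<⇒≢ (ℕ.≤-trans n<x (ℕ.m≤m+n x _)))))
      where x = suc u₁ * suc v₁

open DoubleShuffle
open import Data.Rational using (_+_; _*_; _-_; -_)
open +-*-Solver using (solve; _:=_; _:+_; _:*_; _:-_; :-_; con)

-- The embedding of the natural numbers into the rationals.

fromℚᵘ-homo-+ : ∀ p q → fromℚᵘ (p ℚᵘ.+ q) ≡ fromℚᵘ p + fromℚᵘ q
fromℚᵘ-homo-+ p q = ℚ.toℚᵘ-injective (ℚᵘ.≃-trans (ℚ.toℚᵘ-fromℚᵘ (p ℚᵘ.+ q))
  (ℚᵘ.≃-sym (ℚᵘ.≃-trans (ℚ.toℚᵘ-homo-+ (fromℚᵘ p) (fromℚᵘ q))
    (ℚᵘ.+-cong (ℚ.toℚᵘ-fromℚᵘ p) (ℚ.toℚᵘ-fromℚᵘ q)))))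

fromℚᵘ-homo-* : ∀ p q → fromℚᵘ (p ℚᵘ.* q) ≡ fromℚᵘ p * fromℚᵘ q
fromℚᵘ-homo-* p q = ℚ.toℚᵘ-injective (ℚᵘ.≃-trans (ℚ.toℚᵘ-fromℚᵘ (p ℚᵘ.* q))
  (ℚᵘ.≃-sym (ℚᵘ.≃-trans (ℚ.toℚᵘ-homo-* (fromℚᵘ p) (fromℚᵘ q))
    (ℚᵘ.*-cong (ℚ.toℚᵘ-fromℚᵘ p) (ℚ.toℚᵘ-fromℚᵘ q)))))

-- Has the form of `invFact`, so that `1/ι-inverse` applies to inverse factorials directly.
1/ι : ∀ n .{{_ : NonZero n}} → ℚ
1/ι n = ℤ.1ℤ ℚ./ n

-- Opaque because unification would otherwise unfold the gcd computation inside _/_.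
opaque
  ι : ℕ → ℚ
  ι n = ℤ.+ n ℚ./ 1

  ι≡/1 : ∀ n → ι n ≡ ℤ.+ n ℚ./ 1
  ι≡/1 n = refl

  ι-0 : ι 0 ≡ 0ℚ
  ι-0 = refl

  ι-1 : ι 1 ≡ 1ℚ
  ι-1 = refl

  ι-+ : ∀ m n → ι (m ℕ.+ n) ≡ ι m + ι n
  ι-+ m n = trans (ℚ.fromℚᵘ-cong {mkℚᵘ (ℤ.+ (m ℕ.+ n)) 0} {mkℚᵘ (ℤ.+ m) 0 ℚᵘ.+ mkℚᵘ (ℤ.+ n) 0}
    (*≡* (cong (ℤ._* ℤ.1ℤ) (trans (ℤ.pos-+ m n)
      (cong₂ ℤ._+_ (sym (ℤ.*-identityʳ (ℤ.+ m))) (sym (ℤ.*-identityʳ (ℤ.+ n))))))))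
    (fromℚᵘ-homo-+ (mkℚᵘ (ℤ.+ m) 0) (mkℚᵘ (ℤ.+ n) 0))

  ι-* : ∀ m n → ι (m ℕ.* n) ≡ ι m * ι n
  ι-* m n = trans (ℚ.fromℚᵘ-cong {mkℚᵘ (ℤ.+ (m ℕ.* n)) 0} {mkℚᵘ (ℤ.+ m) 0 ℚᵘ.* mkℚᵘ (ℤ.+ n) 0}
    (*≡* (cong (ℤ._* ℤ.1ℤ) (ℤ.pos-* m n))))
    (fromℚᵘ-homo-* (mkℚᵘ (ℤ.+ m) 0) (mkℚᵘ (ℤ.+ n) 0))

  1/ι-inverse : ∀ n .{{_ : NonZero n}} → 1/ι n * ι n ≡ 1ℚ
  1/ι-inverse n@(suc m) = trans (sym (fromℚᵘ-homo-* (mkℚᵘ ℤ.1ℤ m) (mkℚᵘ (ℤ.+ n) 0)))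
    (ℚ.fromℚᵘ-cong {mkℚᵘ ℤ.1ℤ m ℚᵘ.* mkℚᵘ (ℤ.+ n) 0} {mkℚᵘ ℤ.1ℤ 0}
      (*≡* (trans (ℤ.*-identityʳ (ℤ.1ℤ ℤ.* ℤ.+ n)) (cong (λ s → ℤ.1ℤ ℤ.* ℤ.+ s) (sym (ℕ.*-identityʳ n))))))

ι-Σ : ∀ n f → ι (S.Σ< n f) ≡ Q.Σ< n (ι ∘ f)
ι-Σ zero    f = ι-0
ι-Σ (suc n) f = trans (ι-+ (f 0) _) (cong (ι (f 0) +_) (ι-Σ n (f ∘ suc)))

invFact-inverse : ∀ s → invFact s * ι ((s ∸ 1) !) ≡ 1ℚ
invFact-inverse s = 1/ι-inverse ((s ∸ 1) !) {{(s ∸ 1) ℕ.!≢0}}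

-- Polynomials without constant term.

-- Rational polynomials of degree at most d without constant term: the function v ↦ v^r is
-- sent to an admissible bracket by divisorSum only for r ≥ 1.
data Poly₀ (d : ℕ) (h : ℕ → ℚ) : Set where
  nil  : (∀ v → h v ≡ 0ℚ) → Poly₀ d h
  cons : ∀ {r g} c → r < d → Poly₀ d g → (∀ v → h v ≡ c * ι (v ^ suc r) + g v) → Poly₀ d h

module _ {d : ℕ} where
  Poly₀-pow : ∀ {r} → r < d → Poly₀ d (λ v → ι (v ^ suc r))
  Poly₀-pow {r} r<d = cons 1ℚ r<d (nil {h = λ _ → 0ℚ} λ _ → refl)
    λ v → sym (trans (ℚ.+-identityʳ _) (ℚ.*-identityˡ _))

  Poly₀-resp : ∀ {f g} → (∀ v → g v ≡ f v) → Poly₀ d f → Poly₀ d g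
  Poly₀-resp g≡f (nil f≡0)         = nil λ v → trans (g≡f v) (f≡0 v)
  Poly₀-resp g≡f (cons c r<d p eq) = cons c r<d p λ v → trans (g≡f v) (eq v)

  Poly₀-scale : ∀ {f} c → Poly₀ d f → Poly₀ d (λ v → c * f v)
  Poly₀-scale c (nil f≡0) = nil λ v → trans (cong (c *_) (f≡0 v)) (ℚ.*-zeroʳ c)
  Poly₀-scale c (cons c′ r<d p eq) = cons (c * c′) r<d (Poly₀-scale c p) λ v →
    trans (cong (c *_) (eq v))
      (solve 4 (λ c c′ x y → c :* (c′ :* x :+ y) := c :* c′ :* x :+ c :* y) refl c c′ _ _)

  Poly₀-+ : ∀ {f g} → Poly₀ d f → Poly₀ d g → Poly₀ d (λ v → f v + g v)
  Poly₀-+ (nil f≡0) q = Poly₀-resp (λ v → trans (cong (_+ _) (f≡0 v)) (ℚ.+-identityˡ _)) q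
  Poly₀-+ {g = g} (cons {r} {g′} c r<d p eq) q = cons c r<d (Poly₀-+ p q) λ v →
    trans (cong (_+ g v) (eq v)) (ℚ.+-assoc (c * ι (v ^ suc r)) (g′ v) (g v))

  Poly₀-- : ∀ {f g} → Poly₀ d f → Poly₀ d g → Poly₀ d (λ v → f v - g v)
  Poly₀-- {f} {g} p q = Poly₀-resp
    (λ v → solve 2 (λ x y → x :- y := x :+ con (- 1ℚ) :* y) refl (f v) (g v))
    (Poly₀-+ p (Poly₀-scale (- 1ℚ) q))

  Poly₀-Σ : ∀ n {f : ℕ → ℕ → ℚ} → (∀ i → i < n → Poly₀ d (f i)) → Poly₀ d (λ v → Q.Σ< n (λ i → f i v))
  Poly₀-Σ zero    p = nil λ _ → refl
  Poly₀-Σ (suc n) p = Poly₀-+ (p 0 (s≤s z≤n)) (Poly₀-Σ n λ i i<n → p (suc i) (s≤s i<n))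

Poly₀-weaken : ∀ {d e f} → d ≤ e → Poly₀ d f → Poly₀ e f
Poly₀-weaken d≤e (nil f≡0)         = nil f≡0
Poly₀-weaken d≤e (cons c r<d p eq) = cons c (ℕ.≤-trans r<d d≤e) (Poly₀-weaken d≤e p) eq

Poly₀-shift : ∀ {d f} → Poly₀ d f → Poly₀ (suc d) (λ v → ι v * f v)
Poly₀-shift (nil f≡0) = nil λ v → trans (cong (ι v *_) (f≡0 v)) (ℚ.*-zeroʳ (ι v))
Poly₀-shift (cons {r} c r<d p eq) = cons c (s≤s r<d) (Poly₀-shift p) λ v →
  trans (cong (ι v *_) (eq v)) (trans
    (solve 4 (λ x c y z → x :* (c :* y :+ z) := c :* (x :* y) :+ x :* z) refl (ι v) c (ι (v ^ suc r)) _)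
    (cong (λ s → c * s + _) (sym (ι-* v (v ^ suc r)))))

-- Power sums are polynomials without constant term.

-- The summand at i = 0 vanishes for a ≥ 1; for a = 0 it is what keeps Σ_{i<v} i^0 = v free
-- of a constant term.
powerSum : ℕ → ℕ → ℕ → ℕ
powerSum a b v = S.Σ< v λ i → i ^ a ℕ.* (v ∸ i) ^ b

-- From (v - i) + i = v for i < v. It trades a factor v - i for a factor i and so reduces b to 0.
powerSum-rec : ∀ a b v → powerSum a (suc b) v ℕ.+ powerSum (suc a) b v ≡ v ℕ.* powerSum a b v
powerSum-rec a b v = trans (sym (S.Σ-+ v _ _)) (trans (S.Σ-cong v step) (S.Σ-*ˡ v v _))
  where
  arith : ∀ i w p q → p ℕ.* (w ℕ.* q) ℕ.+ (i ℕ.* p) ℕ.* q ≡ (w ℕ.+ i) ℕ.* (p ℕ.* q)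
  arith = solve-∀
  step : ∀ i → i < v → i ^ a ℕ.* (v ∸ i) ^ suc b ℕ.+ i ^ suc a ℕ.* (v ∸ i) ^ b ≡ v ℕ.* (i ^ a ℕ.* (v ∸ i) ^ b)
  step i i<v = trans (arith i (v ∸ i) (i ^ a) ((v ∸ i) ^ b))
    (cong (ℕ._* (i ^ a ℕ.* (v ∸ i) ^ b)) (ℕ.m∸n+n≡m (ℕ.<⇒≤ i<v)))

-- The sum over i < v of (i + 1)^(a+1) - i^(a+1), expanded binomially. The proof is by induction on
-- `v`.
telescope : ∀ a v → S.Σ< (suc a) (λ j → (suc a C j) ℕ.* powerSum j 0 v) ≡ v ^ suc a
telescope a zero    = S.Σ-zero (suc a) λ j _ → ℕ.*-zeroʳ (suc a C j)
telescope a (suc v) = begin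
  S.Σ< (suc a) (λ j → (suc a C j) ℕ.* powerSum j 0 (suc v))
    ≡⟨ S.Σ-cong (suc a) (λ j _ → trans (cong ((suc a C j) ℕ.*_) (S.Σ-last v λ i → i ^ j ℕ.* 1)) (ℕ.*-distribˡ-+ (suc a C j) (powerSum j 0 v) (v ^ j ℕ.* 1))) ⟩
  S.Σ< (suc a) (λ j → (suc a C j) ℕ.* powerSum j 0 v ℕ.+ (suc a C j) ℕ.* (v ^ j ℕ.* 1))
    ≡⟨ S.Σ-+ (suc a) (λ j → (suc a C j) ℕ.* powerSum j 0 v) (λ j → (suc a C j) ℕ.* (v ^ j ℕ.* 1)) ⟩
  S.Σ< (suc a) (λ j → (suc a C j) ℕ.* powerSum j 0 v) ℕ.+ S.Σ< (suc a) (λ j → (suc a C j) ℕ.* (v ^ j ℕ.* 1))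
    ≡⟨ cong₂ ℕ._+_ (telescope a v) (S.Σ-cong (suc a) λ j _ → cong ((suc a C j) ℕ.*_) (mono-1 j)) ⟩
  v ^ suc a ℕ.+ S.Σ< (suc a) f
    ≡⟨ ℕ.+-comm (v ^ suc a) _ ⟩
  S.Σ< (suc a) f ℕ.+ v ^ suc a
    -- The induction hypothesis v^(a+1) is exactly the missing term j = a + 1 of the expansion of (1
    -- + v)^(a+1).
    ≡⟨ cong (S.Σ< (suc a) f ℕ.+_) (trans (sym (ℕ.*-identityˡ _))
         (cong₂ ℕ._*_ (sym (nCn≡1 (suc a))) (trans (sym (ℕ.*-identityʳ _)) (mono-1 (suc a))))) ⟩
  S.Σ< (suc a) f ℕ.+ f (suc a)
    ≡⟨ S.Σ-last (suc a) f ⟨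
  S.Σ< (suc (suc a)) f
    ≡⟨ binomial (suc (suc a)) (suc a) 0 1 v ℕ.≤-refl ⟨
  suc v ^ suc a ℕ.* 1
    ≡⟨ ℕ.*-identityʳ _ ⟩
  suc v ^ suc a ∎
  where
  open ≡-Reasoning
  f : ℕ → ℕ
  f j = (suc a C j) ℕ.* mono ((suc a ℕ.+ 0) ∸ j) j 1 v
  mono-1 : ∀ j → v ^ j ℕ.* 1 ≡ mono ((suc a ℕ.+ 0) ∸ j) j 1 v
  mono-1 j = trans (ℕ.*-comm (v ^ j) 1) (cong (ℕ._* v ^ j) (sym (ℕ.^-zeroˡ ((suc a ℕ.+ 0) ∸ j))))

[1+n]Cn≡1+n : ∀ n → suc n C n ≡ suc n
[1+n]Cn≡1+n n = trans (nCk≡nC[n∸k] (ℕ.n≤1+n n)) (trans (cong (suc n C_) (ℕ.m+n∸n≡m 1 n)) (nC1≡n (suc n)))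

-- `telescope` is solved for its last power sum, whose coefficient a + 1 is invertible; the others
-- have smaller exponent. The bound `m` is the fuel for this course-of-values induction on `a`.
faulhaber : ∀ m a → a < m → Poly₀ (suc a) (ι ∘ powerSum a 0)
faulhaber (suc m) a (s≤s a≤m) = Poly₀-resp solved
  (Poly₀-scale (1/ι (suc a)) (Poly₀-- (Poly₀-pow ℕ.≤-refl)
    (Poly₀-Σ a λ j j<a → Poly₀-scale (ι (suc a C j))
      (Poly₀-weaken (s≤s (ℕ.<⇒≤ j<a)) (faulhaber m j (ℕ.≤-trans j<a a≤m))))))
  where
  open ≡-Reasoning
  lower : ℕ → ℚ
  lower v = Q.Σ< a (λ j → ι (suc a C j) * ι (powerSum j 0 v))
  split : ∀ v → ι (v ^ suc a) ≡ lower v + ι (suc a) * ι (powerSum a 0 v)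
  split v = begin
    ι (v ^ suc a) ≡⟨ cong ι (telescope a v) ⟨
    ι (S.Σ< (suc a) (λ j → (suc a C j) ℕ.* powerSum j 0 v)) ≡⟨ ι-Σ (suc a) (λ j → (suc a C j) ℕ.* powerSum j 0 v) ⟩
    Q.Σ< (suc a) (λ j → ι ((suc a C j) ℕ.* powerSum j 0 v))
      ≡⟨ Q.Σ-cong (suc a) (λ j _ → ι-* (suc a C j) (powerSum j 0 v)) ⟩
    Q.Σ< (suc a) (λ j → ι (suc a C j) * ι (powerSum j 0 v)) ≡⟨ Q.Σ-last a _ ⟩
    lower v + ι (suc a C a) * ι (powerSum a 0 v)
      ≡⟨ cong (λ s → lower v + ι s * ι (powerSum a 0 v)) ([1+n]Cn≡1+n a) ⟩
    lower v + ι (suc a) * ι (powerSum a 0 v) ∎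
  solved : ∀ v → ι (powerSum a 0 v) ≡ 1/ι (suc a) * (ι (v ^ suc a) - lower v)
  solved v = sym (begin
    1/ι (suc a) * (ι (v ^ suc a) - lower v)
      ≡⟨ cong (λ s → 1/ι (suc a) * (s - lower v)) (split v) ⟩
    1/ι (suc a) * ((lower v + ι (suc a) * ι (powerSum a 0 v)) - lower v)
      ≡⟨ solve 4 (λ i l x y → i :* ((l :+ x :* y) :- l) := (i :* x) :* y) refl (1/ι (suc a)) (lower v) _ _ ⟩
    (1/ι (suc a) * ι (suc a)) * ι (powerSum a 0 v)
      ≡⟨ cong (_* ι (powerSum a 0 v)) (1/ι-inverse (suc a)) ⟩
    1ℚ * ι (powerSum a 0 v) ≡⟨ ℚ.*-identityˡ _ ⟩
    ι (powerSum a 0 v) ∎)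

-- Induction on `b` through `powerSum-rec`: multiplication by v raises the degree by one, and
-- trading exponents keeps a + b.
powerSum-Poly₀ : ∀ a b → Poly₀ (suc (a ℕ.+ b)) (ι ∘ powerSum a b)
powerSum-Poly₀ a zero    = subst (λ s → Poly₀ (suc s) (ι ∘ powerSum a 0)) (sym (ℕ.+-identityʳ a)) (faulhaber (suc a) a ℕ.≤-refl)
powerSum-Poly₀ a (suc b) = subst (λ s → Poly₀ (suc s) (ι ∘ powerSum a (suc b))) (sym (ℕ.+-suc a b))
  (Poly₀-resp solved (Poly₀-- (Poly₀-shift (powerSum-Poly₀ a b)) (powerSum-Poly₀ (suc a) b)))
  where
  solved : ∀ v → ι (powerSum a (suc b) v) ≡ ι v * ι (powerSum a b v) - ι (powerSum (suc a) b v)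
  solved v = sym (trans (cong (_- y) (trans (sym (ι-* v _)) (trans (cong ι (sym (powerSum-rec a b v))) (ι-+ (powerSum a (suc b) v) _))))
    (solve 2 (λ x y → (x :+ y) :- y := x) refl (ι (powerSum a (suc b) v)) y))
    where y = ι (powerSum (suc a) b v)

-- Divisor sums and brackets of length one.

-- For n ≥ 1 this sums `f` over the divisors of n. It is kept as a double sum over uv = n, the shape
-- in which `σ₁` and `equalSum` arrive.
divisorSum : (ℕ → ℚ) → ℕ → ℚ
divisorSum f n = Q.Σ< n λ u → Q.Σ< n λ v → ι (δ n (suc u ℕ.* suc v)) * f (suc v)

divisorSum-ι : ∀ (f : ℕ → ℕ) n →
  ι (S.Σ< n λ u → S.Σ< n λ v → δ n (suc u ℕ.* suc v) ℕ.* f (suc v)) ≡ divisorSum (ι ∘ f) n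
divisorSum-ι f n = trans (ι-Σ n _) (Q.Σ-cong n λ u _ → trans (ι-Σ n _) (Q.Σ-cong n λ v _ → ι-* _ (f (suc v))))

divisorSum-linear : ∀ c d f g n → divisorSum (λ v → c * f v + d * g v) n ≡ c * divisorSum f n + d * divisorSum g n
divisorSum-linear c d f g n = trans (Q.Σ-cong n λ u _ → trans
    (Q.Σ-cong n λ v _ → distr (ι (δ n (suc u ℕ.* suc v))) (f (suc v)) (g (suc v)))
    (linear (λ v → ι (δ n (suc u ℕ.* suc v)) * f (suc v)) (λ v → ι (δ n (suc u ℕ.* suc v)) * g (suc v))))
  (linear _ _)
  where
  linear : ∀ p q → Q.Σ< n (λ v → c * p v + d * q v) ≡ c * Q.Σ< n p + d * Q.Σ< n q
  linear p q = trans (Q.Σ-+ n (λ v → c * p v) (λ v → d * q v)) (cong₂ _+_ (Q.Σ-*ˡ n c p) (Q.Σ-*ˡ n d q))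
  distr : ∀ w x y → w * (c * x + d * y) ≡ c * (w * x) + d * (w * y)
  distr w x y = solve 5 (λ c d w x y → w :* (c :* x :+ d :* y) := c :* (w :* x) :+ d :* (w :* y)) refl c d w x y

divisorSum-cong : ∀ {f g} n → (∀ v → f v ≡ g v) → divisorSum f n ≡ divisorSum g n
divisorSum-cong n f≡g = Q.Σ-cong n λ u _ → Q.Σ-cong n λ v _ → cong (ι (δ n (suc u ℕ.* suc v)) *_) (f≡g (suc v))

-- As uv₁ + uv₂ = u(v₁ + v₂), the solutions are grouped by v = v₁ + v₂, and v₁ runs over 0 < v₁ < v.
-- The index 0 of `powerSum` adds nothing because the first exponent is positive.
equalSum-powerSum : ∀ a b n → ι (equalSum (mono (suc a) b) n) ≡ divisorSum (ι ∘ powerSum (suc a) b) n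
equalSum-powerSum a b n = trans (cong ι (S.Σ-cong n λ u _ → trans
    (S.Σ-cong n λ v₁ _ → S.Σ-cong n λ v₂ _ → cong₂ (λ s t → δ n s ℕ.* (suc v₁ ^ suc a ℕ.* t ^ b))
      (arith u v₁ v₂) (sym (trans (cong (_∸ v₁) (sym (ℕ.+-suc v₁ v₂))) (ℕ.m+n∸m≡n v₁ (suc v₂)))))
    (trans (sym (S.Σ-triangle n (f u) ℕ.≤-refl λ v v₁ n≤v → cong (ℕ._* (suc v₁ ^ suc a ℕ.* (v ∸ v₁) ^ b))
              (δ-≢ (ℕ.<⇒≢ (ℕ.≤-trans (s≤s n≤v) (ℕ.m≤m+n (suc v) (u ℕ.* suc v)))))))
      (S.Σ-cong n λ v _ → S.Σ-*ˡ v (δ n (suc u ℕ.* suc v)) (λ v₁ → suc v₁ ^ suc a ℕ.* (v ∸ v₁) ^ b)))))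
  (divisorSum-ι (powerSum (suc a) b) n)
  where
  f : ℕ → ℕ → ℕ → ℕ
  f u v v₁ = δ n (suc u ℕ.* suc v) ℕ.* (suc v₁ ^ suc a ℕ.* (v ∸ v₁) ^ b)
  arith : ∀ u v₁ v₂ → suc u ℕ.* suc v₁ ℕ.+ suc u ℕ.* suc v₂ ≡ suc u ℕ.* suc (suc (v₁ ℕ.+ v₂))
  arith = solve-∀

InFil-nil : ∀ {k l h} → (∀ n → h n ≡ 0ℚ) → InFil k l h
InFil-nil h≡0 = [] , [] , h≡0

InFil-cons : ∀ {k l g h} c ss → Generator k l ss → InFil k l g → (∀ n → h n ≡ c * bracket ss n + g n) → InFil k l h
InFil-cons c ss gen (L , gens , g≡L) eq =
  (c , ss) ∷ L , gen ∷ gens , λ n → trans (eq n) (cong (c * bracket ss n +_) (g≡L n))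

bracket₁ : ∀ r n → ι (r !) * bracket (suc r ∷ []) n ≡ divisorSum (λ v → ι (v ^ r)) n
bracket₁ r n = begin
  ι (r !) * (ℤ.+ σ (r ∷ []) n ℚ./ 1 * (i * 1ℚ))  ≡⟨ cong (λ s → ι (r !) * (s * (i * 1ℚ))) (ι≡/1 (σ (r ∷ []) n)) ⟨
  ι (r !) * (ι (σ (r ∷ []) n) * (i * 1ℚ))
    ≡⟨ solve 3 (λ f s i → f :* (s :* (i :* con 1ℚ)) := i :* f :* s) refl (ι (r !)) (ι (σ (r ∷ []) n)) i ⟩
  i * ι (r !) * ι (σ (r ∷ []) n)                  ≡⟨ cong (_* ι (σ (r ∷ []) n)) (invFact-inverse (suc r)) ⟩
  1ℚ * ι (σ (r ∷ []) n)                           ≡⟨ ℚ.*-identityˡ _ ⟩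
  ι (σ (r ∷ []) n)                                ≡⟨ cong ι (σ₁ r n) ⟩
  ι (S.Σ< n λ u → S.Σ< n λ v → δ n (suc u ℕ.* suc v) ℕ.* suc v ^ r)  ≡⟨ divisorSum-ι (_^ r) n ⟩
  divisorSum (λ v → ι (v ^ r)) n ∎
  where
  open ≡-Reasoning
  i = invFact (suc r)

bracket₂ : ∀ a b n → ι (a !) * ι (b !) * bracket (suc a ∷ suc b ∷ []) n ≡ ι (decreasingSum (mono a b) n)
bracket₂ a b n = begin
  ι (a !) * ι (b !) * (ℤ.+ s ℚ./ 1 * (i * (j * 1ℚ)))
    ≡⟨ cong (λ t → ι (a !) * ι (b !) * (t * (i * (j * 1ℚ)))) (ι≡/1 s) ⟨
  ι (a !) * ι (b !) * (ι s * (i * (j * 1ℚ)))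
    ≡⟨ solve 5 (λ f g s i j → f :* g :* (s :* (i :* (j :* con 1ℚ))) := i :* f :* (j :* g) :* s) refl (ι (a !)) (ι (b !)) (ι s) i j ⟩
  i * ι (a !) * (j * ι (b !)) * ι s
    ≡⟨ cong₂ (λ x y → x * y * ι s) (invFact-inverse (suc a)) (invFact-inverse (suc b)) ⟩
  1ℚ * 1ℚ * ι s            ≡⟨ ℚ.*-identityˡ (ι s) ⟩
  ι s                       ≡⟨ cong ι (σ₂ a b n) ⟩
  ι (decreasingSum (mono a b) n) ∎
  where
  open ≡-Reasoning
  s = σ (a ∷ b ∷ []) n
  i = invFact (suc a)
  j = invFact (suc b)

-- Each v^(r+1) yields (r + 1)! times [r + 2], which is admissible of weight r + 2 ≤ d + 1. A
-- constant term would produce the non-admissible [1].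
divisorSum-InFil : ∀ {d k f} → suc d ≤ k → Poly₀ d f → InFil k 1 (divisorSum f)
divisorSum-InFil d<k (nil f≡0) = InFil-nil λ n → Q.Σ-zero n λ u _ → Q.Σ-zero n λ v _ →
  trans (cong (ι (δ n (suc u ℕ.* suc v)) *_) (f≡0 (suc v))) (ℚ.*-zeroʳ (ι (δ n (suc u ℕ.* suc v))))
divisorSum-InFil {k = k} d<k (cons {r} {g} c r<d p eq) = InFil-cons (c * ι (suc r !)) (suc (suc r) ∷ [])
  (inj₂ (s≤s (s≤s z≤n) , s≤s z≤n ∷ [] ,
    subst (_≤ k) (sym (ℕ.+-identityʳ _)) (ℕ.≤-trans (s≤s r<d) d<k) , ℕ.≤-refl))
  (divisorSum-InFil d<k p) λ n → begin
    _ ≡⟨ divisorSum-cong n (λ v → trans (eq v) (cong (c * ι (v ^ suc r) +_) (sym (ℚ.*-identityˡ (g v))))) ⟩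
    divisorSum (λ v → c * ι (v ^ suc r) + 1ℚ * g v) n
      ≡⟨ divisorSum-linear c 1ℚ (λ v → ι (v ^ suc r)) g n ⟩
    c * divisorSum (λ v → ι (v ^ suc r)) n + 1ℚ * divisorSum g n
      ≡⟨ cong₂ (λ s t → c * s + t) (sym (bracket₁ (suc r) n)) (ℚ.*-identityˡ _) ⟩
    c * (ι (suc r !) * bracket (suc (suc r) ∷ []) n) + divisorSum g n
      ≡⟨ cong (_+ divisorSum g n) (sym (ℚ.*-assoc c _ _)) ⟩
    c * ι (suc r !) * bracket (suc (suc r) ∷ []) n + divisorSum g n ∎
  where open ≡-Reasoning

-- The strictly lower triangular matrix [i = j] - C(i,j).

kronecker : ℕ → ℕ → ℚ
kronecker i j = ι (δ i j)

kronecker-refl : ∀ i → kronecker i i ≡ 1ℚ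
kronecker-refl i = trans (cong ι (δ-refl i)) ι-1

kronecker-≢ : ∀ {i j} → i ≢ j → kronecker i j ≡ 0ℚ
kronecker-≢ i≢j = trans (cong ι (δ-≢ i≢j)) ι-0

Σ-kronecker : ∀ {m i} (f : ℕ → ℚ) → i < m → Q.Σ< m (λ j → kronecker i j * f j) ≡ f i
Σ-kronecker {suc m} {zero}  f _ = trans
  (cong₂ _+_ (trans (cong (_* f 0) (kronecker-refl 0)) (ℚ.*-identityˡ (f 0)))
    (Q.Σ-zero m λ j _ → trans (cong (_* f (suc j)) (kronecker-≢ {0} {suc j} λ ())) (ℚ.*-zeroˡ (f (suc j)))))
  (ℚ.+-identityʳ (f 0))
Σ-kronecker {suc m} {suc i} f (s≤s i<m) = trans
  (cong₂ _+_ (trans (cong (_* f 0) (kronecker-≢ {suc i} {0} λ ())) (ℚ.*-zeroˡ (f 0))) (Σ-kronecker (f ∘ suc) i<m))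
  (ℚ.+-identityˡ (f (suc i)))

-- The row index i stands for the pair (i, N − i), the column index j for σ_{N−j,j}.
defect : ℕ → ℕ → ℚ
defect i j = kronecker i j - ι (i C j)

defect-≤ : ∀ {i j} → i ≤ j → defect i j ≡ 0ℚ
defect-≤ {i} {j} i≤j with i ℕ.≟ j
... | yes refl = trans (cong₂ _-_ (kronecker-refl i) (trans (cong ι (nCn≡1 i)) ι-1)) refl
... | no  i≢j  = cong₂ _-_ (kronecker-≢ i≢j) (trans (cong ι (k>n⇒nCk≡0 (ℕ.≤∧≢⇒< i≤j i≢j))) ι-0)

*-cancelʳ-0 : ∀ {x y} z → y * z ≡ 1ℚ → x * y ≡ 0ℚ → x ≡ 0ℚ
*-cancelʳ-0 {x} {y} z yz≡1 xy≡0 = begin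
  x            ≡⟨ ℚ.*-identityʳ x ⟨
  x * 1ℚ       ≡⟨ cong (x *_) yz≡1 ⟨
  x * (y * z)  ≡⟨ ℚ.*-assoc x y z ⟨
  x * y * z    ≡⟨ cong (_* z) xy≡0 ⟩
  0ℚ * z       ≡⟨ ℚ.*-zeroˡ z ⟩
  0ℚ           ∎
  where open ≡-Reasoning

-- The entry just below the diagonal is -C(j+1, j) = -(j + 1).
defect-suc : ∀ j → defect (suc j) j * (- 1/ι (suc j)) ≡ 1ℚ
defect-suc j = begin
  defect (suc j) j * (- 1/ι (suc j))
    ≡⟨ cong₂ (λ s t → (s - ι t) * (- 1/ι (suc j))) (kronecker-≢ {suc j} {j} λ ()) ([1+n]Cn≡1+n j) ⟩
  (0ℚ - ι (suc j)) * (- 1/ι (suc j))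
    ≡⟨ solve 2 (λ x i → (con 0ℚ :- x) :* (:- i) := i :* x) refl (ι (suc j)) (1/ι (suc j)) ⟩
  1/ι (suc j) * ι (suc j) ≡⟨ 1/ι-inverse (suc j) ⟩
  1ℚ ∎
  where open ≡-Reasoning

-- Among the rows 0, ..., N + 1, only the last has a nonzero entry in column N.
defect-top : ∀ N (Φ : ℕ → ℚ) → Q.Σ< (suc (suc N)) (λ i → Φ i * defect i N) ≡ 0ℚ → Φ (suc N) ≡ 0ℚ
defect-top N Φ ker = *-cancelʳ-0 (- 1/ι (suc N)) (defect-suc N) (begin
  Φ (suc N) * defect (suc N) N                                      ≡⟨ ℚ.+-identityˡ _ ⟨
  0ℚ + Φ (suc N) * defect (suc N) N
    ≡⟨ cong (_+ Φ (suc N) * defect (suc N) N) (Q.Σ-zero (suc N) {λ i → Φ i * defect i N} λ { i (s≤s i≤N) →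
         trans (cong (Φ i *_) (defect-≤ i≤N)) (ℚ.*-zeroʳ (Φ i)) }) ⟨
  Q.Σ< (suc N) (λ i → Φ i * defect i N) + Φ (suc N) * defect (suc N) N   ≡⟨ Q.Σ-last (suc N) (λ i → Φ i * defect i N) ⟨
  Q.Σ< (suc (suc N)) (λ i → Φ i * defect i N)                       ≡⟨ ker ⟩
  0ℚ ∎)
  where open ≡-Reasoning

-- Back substitution: the last column kills the last coordinate, and the smaller matrix remains. Row
-- 0 is zero, so Φ 0 stays undetermined; hence the condition 0 < i.
defect-triangular : ∀ N (Φ : ℕ → ℚ) → (∀ j → j < N → Q.Σ< (suc N) (λ i → Φ i * defect i j) ≡ 0ℚ) →
  ∀ i → 0 < i → i ≤ N → Φ i ≡ 0ℚ
defect-triangular zero    Φ _ (suc i) _ ()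
defect-triangular (suc N) Φ ker i 0<i i≤N with ℕ.m≤n⇒m<n∨m≡n i≤N
... | inj₂ refl       = defect-top N Φ (ker N ℕ.≤-refl)
... | inj₁ (s≤s i≤N′) = defect-triangular N Φ (λ j j<N → begin
    Q.Σ< (suc N) (λ i → Φ i * defect i j)                             ≡⟨ ℚ.+-identityʳ _ ⟨
    Q.Σ< (suc N) (λ i → Φ i * defect i j) + 0ℚ
      ≡⟨ cong (Q.Σ< (suc N) (λ i → Φ i * defect i j) +_)
           (trans (cong (_* defect (suc N) j) (defect-top N Φ (ker N ℕ.≤-refl))) (ℚ.*-zeroˡ (defect (suc N) j))) ⟨
    Q.Σ< (suc N) (λ i → Φ i * defect i j) + Φ (suc N) * defect (suc N) j   ≡⟨ Q.Σ-last (suc N) (λ i → Φ i * defect i j) ⟨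
    Q.Σ< (suc (suc N)) (λ i → Φ i * defect i j)                       ≡⟨ ker j (ℕ.m<n⇒m<1+n j<N) ⟩
    0ℚ ∎) i 0<i i≤N′
  where open ≡-Reasoning

-- Pairing the matrix with the values σ_{N-j,j}(n).

-- Rows a and N - a belong to the pair (a, N - a), row N to (N, 0), whose other row 0 is zero.
coefficient : ℕ → ℕ → ℕ → ℚ
coefficient N a j = defect a j + defect (N ∸ a) j - defect N j

defect-pairing : ∀ {N a} n → a ≤ N → Q.Σ< (suc N) (λ j → defect a j * ι (β n N j)) ≡ ι (β n N a) - ι (binomialSum n N a)
defect-pairing {N} {a} n a≤N = begin
  Q.Σ< (suc N) (λ j → defect a j * b j)
    ≡⟨ Q.Σ-cong (suc N) (λ j _ → solve 3 (λ k c x → (k :- c) :* x := k :* x :+ con (- 1ℚ) :* (c :* x)) refl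
         (kronecker a j) (ι (a C j)) (b j)) ⟩
  Q.Σ< (suc N) (λ j → kronecker a j * b j + (- 1ℚ) * (ι (a C j) * b j))
    ≡⟨ Q.Σ-+ (suc N) (λ j → kronecker a j * b j) (λ j → (- 1ℚ) * (ι (a C j) * b j)) ⟩
  Q.Σ< (suc N) (λ j → kronecker a j * b j) + Q.Σ< (suc N) (λ j → (- 1ℚ) * (ι (a C j) * b j))
    ≡⟨ cong₂ _+_ (Σ-kronecker b (s≤s a≤N)) (trans (Q.Σ-*ˡ (suc N) (- 1ℚ) (λ j → ι (a C j) * b j))
         (cong ((- 1ℚ) *_) (trans (Q.Σ-cong (suc N) λ j _ → sym (ι-* (a C j) (β n N j)))
           (sym (ι-Σ (suc N) (λ j → (a C j) ℕ.* β n N j)))))) ⟩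
  b a + (- 1ℚ) * ι (binomialSum n N a)
    ≡⟨ solve 2 (λ x y → x :+ con (- 1ℚ) :* y := x :- y) refl (b a) (ι (binomialSum n N a)) ⟩
  b a - ι (binomialSum n N a) ∎
  where
  open ≡-Reasoning
  b : ℕ → ℚ
  b j = ι (β n N j)

binomialSum-0 : ∀ n N → binomialSum n N 0 ≡ β n N 0
binomialSum-0 n N = trans (S.Σ-extend (λ j → (0 C j) ℕ.* β n N j) (s≤s (z≤n {N})) λ { (suc j) _ → refl })
  (trans (ℕ.+-identityʳ _) (ℕ.*-identityˡ _))

-- The difference of `doubleShuffle` for (N, 0) and for (a, N - a): the common diagonal `D` cancels
-- and the two stuffle diagonals remain.
coefficient-pairing : ∀ {N a} n → a ≤ N → Q.Σ< (suc N) (λ j → coefficient N a j * ι (β n N j)) ≡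
  ι (equalSum (mono N 0) n) - ι (equalSum (mono a (N ∸ a)) n)
coefficient-pairing {N} {a} n a≤N = begin
  Q.Σ< (suc N) (λ j → coefficient N a j * ι (β n N j))
    ≡⟨ Q.Σ-cong (suc N) (λ j _ → solve 4 (λ x y z t → (x :+ y :- z) :* t := x :* t :+ y :* t :+ con (- 1ℚ) :* (z :* t))
         refl (defect a j) (defect b j) (defect N j) (ι (β n N j))) ⟩
  Q.Σ< (suc N) (λ j → X a j + X b j + (- 1ℚ) * X N j)
    ≡⟨ trans (Q.Σ-+ (suc N) (λ j → X a j + X b j) (λ j → (- 1ℚ) * X N j))
         (cong₂ _+_ (Q.Σ-+ (suc N) (X a) (X b)) (Q.Σ-*ˡ (suc N) (- 1ℚ) (X N))) ⟩
  Q.Σ< (suc N) (X a) + Q.Σ< (suc N) (X b) + (- 1ℚ) * Q.Σ< (suc N) (X N)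
    ≡⟨ cong₂ (λ s t → s + (- 1ℚ) * t) (cong₂ _+_ (defect-pairing {N} n a≤N) (defect-pairing {N} n (ℕ.m∸n≤m N a))) (defect-pairing {N} n ℕ.≤-refl) ⟩
  (βa - sa) + (βb - sb) + (- 1ℚ) * (βN - sN)
    -- `D` and `β0` are inserted with both signs, so that the right-hand sides of the two instances
    -- of `doubleShuffle` appear whole.
    ≡⟨ solve 8 (λ βa βb βN sa sb sN D β0 →
         (βa :- sa) :+ (βb :- sb) :+ con (- 1ℚ) :* (βN :- sN) :=
         ((D :+ (sN :+ β0)) :- (D :+ (sa :+ sb))) :+ ((βb :+ βa) :- (β0 :+ βN))) refl βa βb βN sa sb sN D β0 ⟩
  ((D + (sN + β0)) - (D + (sa + sb))) + ((βb + βa) - (β0 + βN))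
    ≡⟨ cong₂ (λ s t → (s - t) + ((βb + βa) - (β0 + βN)))
         (trans (sym (cast _ _ _)) (trans (cong ι (trans
           (cong (λ s → equalSumᵛ (mono N 0) n ℕ.+ (binomialSum n N N ℕ.+ s)) (sym (binomialSum-0 n N)))
           (sym (doubleShuffle n N 0 (ℕ.+-identityʳ N))))) (cast _ _ _)))
         (trans (sym (cast _ _ _)) (trans (cong ι (sym (doubleShuffle n a b (ℕ.m+[n∸m]≡n a≤N)))) (cast _ _ _))) ⟩
  ((q₀ + (β0 + βN)) - (q + (βb + βa))) + ((βb + βa) - (β0 + βN))
    ≡⟨ solve 4 (λ q₀ q x y → ((q₀ :+ x) :- (q :+ y)) :+ (y :- x) := q₀ :- q) refl q₀ q (β0 + βN) (βb + βa) ⟩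
  q₀ - q ∎
  where
  open ≡-Reasoning
  b = N ∸ a
  X : ℕ → ℕ → ℚ
  X i j = defect i j * ι (β n N j)
  βa = ι (β n N a)
  βb = ι (β n N b)
  βN = ι (β n N N)
  β0 = ι (β n N 0)
  sa = ι (binomialSum n N a)
  sb = ι (binomialSum n N b)
  sN = ι (binomialSum n N N)
  D  = ι (equalSumᵛ (mono N 0) n)
  q₀ = ι (equalSum (mono N 0) n)
  q  = ι (equalSum (mono a b) n)
  cast : ∀ x y z → ι (x ℕ.+ (y ℕ.+ z)) ≡ ι x + (ι y + ι z)
  cast x y z = trans (ι-+ x (y ℕ.+ z)) (cong (ι x +_) (ι-+ y z))

-- Sums indexed by `Fin`.

ΣFin-toℕ : ∀ m {F : Fin m → ℚ} (f : ℕ → ℚ) → (∀ i → F i ≡ f (toℕ i)) → ΣFin m F ≡ Q.Σ< m f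
ΣFin-toℕ zero    f F≡f = refl
ΣFin-toℕ (suc m) f F≡f = cong₂ _+_ (F≡f Fin.zero) (ΣFin-toℕ m (f ∘ suc) (F≡f ∘ Fin.suc))

ΣFin-cong : ∀ m {F G : Fin m → ℚ} → (∀ i → F i ≡ G i) → ΣFin m F ≡ ΣFin m G
ΣFin-cong zero    F≡G = refl
ΣFin-cong (suc m) F≡G = cong₂ _+_ (F≡G Fin.zero) (ΣFin-cong m (F≡G ∘ Fin.suc))

ΣFin-zero : ∀ m {F : Fin m → ℚ} → (∀ i → F i ≡ 0ℚ) → ΣFin m F ≡ 0ℚ
ΣFin-zero zero    F≡0 = refl
ΣFin-zero (suc m) F≡0 = cong₂ _+_ (F≡0 Fin.zero) (ΣFin-zero m (F≡0 ∘ Fin.suc))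

ΣFin-*ʳ : ∀ m (F : Fin m → ℚ) c → ΣFin m (λ i → F i * c) ≡ ΣFin m F * c
ΣFin-*ʳ zero    F c = sym (ℚ.*-zeroˡ c)
ΣFin-*ʳ (suc m) F c = trans (cong (F Fin.zero * c +_) (ΣFin-*ʳ m (F ∘ Fin.suc) c)) (sym (ℚ.*-distribʳ-+ c (F Fin.zero) (ΣFin m (F ∘ Fin.suc))))

ΣFin-single : ∀ m {F : Fin m → ℚ} i → (∀ j → j ≢ i → F j ≡ 0ℚ) → ΣFin m F ≡ F i
ΣFin-single (suc m) {F} Fin.zero    F≡0 =
  trans (cong (F Fin.zero +_) (ΣFin-zero m λ j → F≡0 (Fin.suc j) λ ())) (ℚ.+-identityʳ _)
ΣFin-single (suc m) {F} (Fin.suc i) F≡0 =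
  trans (cong₂ _+_ (F≡0 Fin.zero λ ()) (ΣFin-single m i λ j j≢i → F≡0 (Fin.suc j) (j≢i ∘ Fin.suc-injective)))
    (ℚ.+-identityˡ _)

ΣFin-swap : ∀ m n (x : Fin m → ℚ) (w : Fin m → ℕ → ℚ) (y : ℕ → ℚ) →
  Q.Σ< n (λ i → ΣFin m (λ t → x t * w t i) * y i) ≡ ΣFin m (λ t → x t * Q.Σ< n (λ i → w t i * y i))
ΣFin-swap zero    n x w y = Q.Σ-zero n λ i _ → ℚ.*-zeroˡ (y i)
ΣFin-swap (suc m) n x w y = begin
  Q.Σ< n (λ i → (x₀ * w₀ i + r i) * y i)
    ≡⟨ Q.Σ-cong n (λ i _ → solve 4 (λ x w r y → (x :* w :+ r) :* y := x :* (w :* y) :+ r :* y) refl x₀ (w₀ i) (r i) (y i)) ⟩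
  Q.Σ< n (λ i → x₀ * (w₀ i * y i) + r i * y i)
    ≡⟨ Q.Σ-+ n (λ i → x₀ * (w₀ i * y i)) (λ i → r i * y i) ⟩
  Q.Σ< n (λ i → x₀ * (w₀ i * y i)) + Q.Σ< n (λ i → r i * y i)
    ≡⟨ cong₂ _+_ (Q.Σ-*ˡ n x₀ (λ i → w₀ i * y i)) (ΣFin-swap m n (x ∘ Fin.suc) (w ∘ Fin.suc) y) ⟩
  ΣFin (suc m) (λ t → x t * Q.Σ< n (λ i → w t i * y i)) ∎
  where
  open ≡-Reasoning
  x₀ = x Fin.zero
  w₀ = w Fin.zero
  r : ℕ → ℚ
  r i = ΣFin m (λ t → x (Fin.suc t) * w (Fin.suc t) i)

m≤⌊n/2⌋⇒m+m≤n : ∀ {m} n → m ≤ ⌊ n /2⌋ → m ℕ.+ m ≤ n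
m≤⌊n/2⌋⇒m+m≤n n m≤ = ℕ.≤-trans (ℕ.+-mono-≤ m≤ (ℕ.≤-trans m≤ (ℕ.⌊n/2⌋≤⌈n/2⌉ n))) (ℕ.≤-reflexive (ℕ.⌊n/2⌋+⌈n/2⌉≡n n))

-- The relations in weight N + 2 and their independence.

module Relations (N : ℕ) where

  private
    m = ⌊ N /2⌋

  -- Runs through 1 ≤ a ≤ N/2. The value a = 0 would compare (N, 0) with itself.
  index : Fin m → ℕ
  index t = suc (toℕ t)

  index+index≤N : ∀ t → index t ℕ.+ index t ≤ N
  index+index≤N t = m≤⌊n/2⌋⇒m+m≤n N (Fin.toℕ<n t)

  index<N : ∀ t → index t < N
  index<N t = ℕ.≤-trans (s≤s (ℕ.m≤n+m (index t) (toℕ t))) (index+index≤N t)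

  -- The product (s₁ - 1)! (s₂ - 1)! for the bracket [i + 2, N - i].
  factor : ℕ → ℚ
  factor i = ι (suc i !) * ι ((N ∸ suc i) !)

  factor⁻¹ : ℕ → ℚ
  factor⁻¹ i = invFact (suc (suc i)) * invFact (suc (N ∸ suc i))

  factor-inverse : ∀ i → factor i * factor⁻¹ i ≡ 1ℚ
  factor-inverse i = trans
    (solve 4 (λ x y z w → x :* y :* (z :* w) := z :* x :* (w :* y)) refl
      (ι (suc i !)) (ι ((N ∸ suc i) !)) (invFact (suc (suc i))) (invFact (suc (N ∸ suc i))))
    (cong₂ _*_ (invFact-inverse (suc (suc i))) (invFact-inverse (suc (N ∸ suc i))))

  -- The bracket [i + 2, N - i] carries σ_{i+1,N-i-1}, hence column j = N - (i + 1). Column N, that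
  -- of the non-admissible [1, N + 1], does not occur.
  rel : Fin m → Fin N → ℚ
  rel t i = coefficient N (index t) (N ∸ suc (toℕ i)) * factor (toℕ i)

  rel-value : ∀ t n → ΣFin N (λ i → rel t i * bracket (br2 (suc (suc N)) i) n) ≡
    ι (equalSum (mono N 0) n) - ι (equalSum (mono (index t) (N ∸ index t)) n)
  rel-value t n = begin
    ΣFin N (λ i → rel t i * bracket (br2 (suc (suc N)) i) n)
      ≡⟨ ΣFin-toℕ N (λ i → g (N ∸ suc i)) summand ⟩
    Q.Σ< N (λ i → g (N ∸ suc i))       ≡⟨ Q.Σ-reverse N g ⟨
    Q.Σ< N g                           ≡⟨ ℚ.+-identityʳ _ ⟨
    -- The absent column N can be added: all three rows have index at most N, so their entries there
    -- vanish.
    Q.Σ< N g + 0ℚ                      ≡⟨ cong (Q.Σ< N g +_) g-N ⟨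
    Q.Σ< N g + g N                     ≡⟨ Q.Σ-last N g ⟨
    Q.Σ< (suc N) g                     ≡⟨ coefficient-pairing {N} n a≤N ⟩
    ι (equalSum (mono N 0) n) - ι (equalSum (mono a (N ∸ a)) n) ∎
    where
    open ≡-Reasoning
    a = index t
    a≤N = ℕ.<⇒≤ (index<N t)
    g : ℕ → ℚ
    g j = coefficient N a j * ι (β n N j)
    g-N : g N ≡ 0ℚ
    g-N = trans (cong (_* ι (β n N N))
      (cong₂ _-_ (cong₂ _+_ (defect-≤ a≤N) (defect-≤ (ℕ.m∸n≤m N a))) (defect-≤ {N} ℕ.≤-refl))) (ℚ.*-zeroˡ (ι (β n N N)))
    summand : ∀ i → rel t i * bracket (br2 (suc (suc N)) i) n ≡ g (N ∸ suc (toℕ i))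
    summand i = begin
      c * factor j * bracket (suc (suc j) ∷ (N ∸ j) ∷ []) n
        ≡⟨ cong (λ s → c * factor j * bracket (suc (suc j) ∷ s ∷ []) n) (ℕ.+-∸-assoc 1 (Fin.toℕ<n i)) ⟩
      c * factor j * bracket (suc (suc j) ∷ suc (N ∸ suc j) ∷ []) n
        ≡⟨ ℚ.*-assoc c _ _ ⟩
      c * (factor j * bracket (suc (suc j) ∷ suc (N ∸ suc j) ∷ []) n)
        ≡⟨ cong (c *_) (bracket₂ (suc j) (N ∸ suc j) n) ⟩
      c * ι (decreasingSum (mono (suc j) (N ∸ suc j)) n)
        ≡⟨ cong (λ s → c * ι (decreasingSum (mono s (N ∸ suc j)) n)) (ℕ.m∸[m∸n]≡n (Fin.toℕ<n i)) ⟨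
      c * ι (β n N (N ∸ suc j)) ∎
      where
      j = toℕ i
      c = coefficient N a (N ∸ suc j)

  rel-isRelation : ∀ t → IsRelation (suc (suc N)) (rel t)
  -- The part of lower weight is 0. The whole value has length one: `f` has degree at most N + 1,
  -- which gives weight at most N + 2 = k.
  rel-isRelation t = (λ _ → 0ℚ) , divisorSum f , InFil-nil (λ _ → refl) , divisorSum-InFil ℕ.≤-refl f-poly ,
    λ n → trans (rel-value t n) (trans (value n) (sym (ℚ.+-identityˡ _)))
    where
    a = index t
    f : ℕ → ℚ
    f v = ι (powerSum N 0 v) - ι (powerSum a (N ∸ a) v)
    f-poly : Poly₀ (suc N) f
    f-poly = Poly₀-- (subst (λ s → Poly₀ (suc s) (ι ∘ powerSum N 0)) (ℕ.+-identityʳ N) (powerSum-Poly₀ N 0))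
      (subst (λ s → Poly₀ (suc s) (ι ∘ powerSum a (N ∸ a))) (ℕ.m+[n∸m]≡n (ℕ.<⇒≤ (index<N t))) (powerSum-Poly₀ a (N ∸ a)))
    -- `equalSum-powerSum` needs a successor as first exponent; N is generalised to M to be matched
    -- as one, and its positivity comes from `index<N`.
    equalSum-N : ∀ {M} n → 0 < M → ι (equalSum (mono M 0) n) ≡ divisorSum (ι ∘ powerSum M 0) n
    equalSum-N {suc M} n _ = equalSum-powerSum M 0 n
    value : ∀ n → ι (equalSum (mono N 0) n) - ι (equalSum (mono a (N ∸ a)) n) ≡ divisorSum f n
    value n = begin
      ι (equalSum (mono N 0) n) - ι (equalSum (mono a (N ∸ a)) n)
        ≡⟨ cong₂ _-_ (equalSum-N n (ℕ.≤-trans (s≤s z≤n) (index<N t))) (equalSum-powerSum (toℕ t) (N ∸ a) n) ⟩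
      divisorSum p n - divisorSum q n
        ≡⟨ solve 2 (λ x y → x :- y := con 1ℚ :* x :+ con (- 1ℚ) :* y) refl (divisorSum p n) (divisorSum q n) ⟩
      1ℚ * divisorSum p n + (- 1ℚ) * divisorSum q n
        ≡⟨ divisorSum-linear 1ℚ (- 1ℚ) p q n ⟨
      divisorSum (λ v → 1ℚ * p v + (- 1ℚ) * q v) n
        ≡⟨ divisorSum-cong n (λ v → solve 2 (λ x y → con 1ℚ :* x :+ con (- 1ℚ) :* y := x :- y) refl (p v) (q v)) ⟩
      divisorSum f n ∎
      where
      open ≡-Reasoning
      p q : ℕ → ℚ
      p = ι ∘ powerSum N 0
      q = ι ∘ powerSum a (N ∸ a)

  -- Coordinates of the relation in the rows of defect.
  weightAt : Fin m → ℕ → ℚ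
  weightAt t i = kronecker (index t) i + kronecker (N ∸ index t) i - kronecker N i

  weightAt-defect : ∀ t j → Q.Σ< (suc N) (λ i → weightAt t i * defect i j) ≡ coefficient N (index t) j
  weightAt-defect t j = begin
    Q.Σ< (suc N) (λ i → weightAt t i * defect i j)
      ≡⟨ Q.Σ-cong (suc N) (λ i _ → solve 4 (λ x y z t → (x :+ y :- z) :* t := x :* t :+ y :* t :+ con (- 1ℚ) :* (z :* t))
           refl (kronecker a i) (kronecker (N ∸ a) i) (kronecker N i) (defect i j)) ⟩
    Q.Σ< (suc N) (λ i → X a i + X (N ∸ a) i + (- 1ℚ) * X N i)
      ≡⟨ trans (Q.Σ-+ (suc N) (λ i → X a i + X (N ∸ a) i) (λ i → (- 1ℚ) * X N i))
           (cong₂ _+_ (Q.Σ-+ (suc N) (X a) (X (N ∸ a))) (Q.Σ-*ˡ (suc N) (- 1ℚ) (X N))) ⟩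
    Q.Σ< (suc N) (X a) + Q.Σ< (suc N) (X (N ∸ a)) + (- 1ℚ) * Q.Σ< (suc N) (X N)
      ≡⟨ cong₂ (λ s t → s + (- 1ℚ) * t)
           (cong₂ _+_ (Σ-kronecker (λ i → defect i j) (s≤s (ℕ.<⇒≤ (index<N t)))) (Σ-kronecker (λ i → defect i j) (s≤s (ℕ.m∸n≤m N a))))
           (Σ-kronecker (λ i → defect i j) (s≤s (ℕ.≤-refl {N}))) ⟩
    defect a j + defect (N ∸ a) j + (- 1ℚ) * defect N j
      ≡⟨ solve 2 (λ x y → x :+ con (- 1ℚ) :* y := x :- y) refl (defect a j + defect (N ∸ a) j) (defect N j) ⟩
    coefficient N a j ∎
    where
    open ≡-Reasoning
    a = index t
    X : ℕ → ℕ → ℚ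
    X k i = kronecker k i * defect i j

  -- N - b = a would mean a + b = N, which for a, b ≤ N/2 forces a = b.
  weightAt-other : ∀ t s → s ≢ t → weightAt s (index t) ≡ 0ℚ
  weightAt-other t s s≢t = cong₂ _-_ (cong₂ _+_ (kronecker-≢ b≢a) (kronecker-≢ N∸b≢a)) (kronecker-≢ (ℕ.>⇒≢ (index<N t)))
    where
    a = index t
    b = index s
    b≢a : b ≢ a
    b≢a b≡a = s≢t (Fin.toℕ-injective (ℕ.suc-injective b≡a))
    N∸b≢a : N ∸ b ≢ a
    N∸b≢a N∸b≡a with ℕ.<-cmp a b
    ... | tri≈ _ a≡b _ = b≢a (sym a≡b)
    ... | tri< a<b _ _ = ℕ.<⇒≱ (ℕ.≤-trans (ℕ.+-monoˡ-< b a<b) (index+index≤N s)) (ℕ.≤-reflexive N≡a+b)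
      where N≡a+b = trans (sym (ℕ.m∸n+n≡m (ℕ.<⇒≤ (index<N s)))) (cong (ℕ._+ b) N∸b≡a)
    ... | tri> _ _ b<a = ℕ.<⇒≱ (ℕ.≤-trans (ℕ.+-monoʳ-< a b<a) (index+index≤N t)) (ℕ.≤-reflexive N≡a+b)
      where N≡a+b = trans (sym (ℕ.m∸n+n≡m (ℕ.<⇒≤ (index<N s)))) (cong (ℕ._+ b) N∸b≡a)

  -- The value is 2 if a = N/2 and 1 otherwise; the successor form makes it visibly invertible.
  weightAt-self : ∀ t → weightAt t (index t) ≡ ι (suc (δ (N ∸ index t) (index t)))
  weightAt-self t = begin
    kronecker a a + k - kronecker N a  ≡⟨ cong₂ (λ x y → x + k - y) (kronecker-refl a) (kronecker-≢ (ℕ.>⇒≢ (index<N t))) ⟩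
    1ℚ + k - 0ℚ                        ≡⟨ ℚ.+-identityʳ _ ⟩
    1ℚ + k                             ≡⟨ cong (_+ k) ι-1 ⟨
    ι 1 + k                            ≡⟨ ι-+ 1 (δ (N ∸ a) a) ⟨
    ι (suc (δ (N ∸ a) a))              ∎
    where
    open ≡-Reasoning
    a = index t
    k = kronecker (N ∸ a) a

  -- A vanishing combination of relations gives a row vector `Φ` annihilated by the columns j < N of
  -- `defect`, so `Φ` vanishes at every index a ≥ 1. At `index t` it equals x t times 1 or 2.
  rel-linIndep : LinIndep m N rel
  rel-linIndep x ker t = *-cancelʳ-0 (1/ι d)
    (trans (cong (_* 1/ι d) (weightAt-self t)) (trans (ℚ.*-comm (ι d) (1/ι d)) (1/ι-inverse d)))
    (trans (sym (ΣFin-single m t λ s s≢t → trans (cong (x s *_) (weightAt-other t s s≢t)) (ℚ.*-zeroʳ (x s))))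
      (defect-triangular N Φ Φ-ker (index t) (s≤s z≤n) (ℕ.<⇒≤ (index<N t))))
    where
    open ≡-Reasoning
    d = suc (δ (N ∸ index t) (index t))
    Φ : ℕ → ℚ
    Φ i = ΣFin m λ s → x s * weightAt s i
    coefficient-ker : ∀ j → j < N → ΣFin m (λ s → x s * coefficient N (index s) j) ≡ 0ℚ
    coefficient-ker j j<N = *-cancelʳ-0 (factor⁻¹ i) (factor-inverse i) (begin
      ΣFin m (λ s → x s * coefficient N (index s) j) * factor i
        ≡⟨ ΣFin-*ʳ m (λ s → x s * coefficient N (index s) j) (factor i) ⟨
      ΣFin m (λ s → x s * coefficient N (index s) j * factor i)
        ≡⟨ ΣFin-cong m (λ s → trans (ℚ.*-assoc (x s) _ _) (cong (x s *_)
             (cong₂ (λ p q → coefficient N (index s) p * factor q) j≡ (sym (Fin.toℕ-fromℕ< i<N))))) ⟩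
      ΣFin m (λ s → x s * rel s (fromℕ< i<N))
        ≡⟨ ker (fromℕ< i<N) ⟩
      0ℚ ∎)
      where
      -- The position of column j among the brackets; j ↦ N - 1 - j is its own inverse.
      i = N ∸ suc j
      i<N : i < N
      i<N = ℕ.∸-monoʳ-< (s≤s z≤n) j<N
      j≡ : j ≡ N ∸ suc (toℕ (fromℕ< i<N))
      j≡ = sym (trans (cong (λ s → N ∸ suc s) (Fin.toℕ-fromℕ< i<N)) (ℕ.suc-injective (trans
        (sym (ℕ.+-∸-assoc 1 i<N)) (ℕ.m∸[m∸n]≡n j<N))))
    Φ-ker : ∀ j → j < N → Q.Σ< (suc N) (λ i → Φ i * defect i j) ≡ 0ℚ
    Φ-ker j j<N = trans (ΣFin-swap m (suc N) x weightAt (λ i → defect i j))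
      (trans (ΣFin-cong m λ s → cong (x s *_) (weightAt-defect s j)) (coefficient-ker j j<N))

mainTheorem6 : (k : ℕ) → 4 ≤ k →
    Σ (Fin (⌊ k /2⌋ ∸ 1) → Fin (k ∸ 2) → ℚ) λ rel →
    ((j : Fin (⌊ k /2⌋ ∸ 1)) → IsRelation k (rel j)) × LinIndep (⌊ k /2⌋ ∸ 1) (k ∸ 2) rel
mainTheorem6 (suc zero)    (s≤s ())
-- For k = N + 2 the numbers ⌊k/2⌋ ∸ 1 and k ∸ 2 reduce to ⌊N/2⌋ and N.
mainTheorem6 (suc (suc N)) _ = rel , rel-isRelation , rel-linIndep
  where open Relations N
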